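{- Let $\alpha=(\alpha_1,\dots,\alpha_l)\in\mathbb Z_{\ge0}^l$, $\mathbf n=(n_1,\dots,n_l)\in\{0,\dots,N\}^l$, and suppose that for some $j\in[l-1]$ we have $\alpha_{j+1}=\alpha_j+1$ and $n_{j+1}=n_j$. Then $J_\alpha(\mathbf n)\equiv0\pmod{I_{\mathrm B}}$. More generally, for any words $\mathsf w^1,\dots,\mathsf w^{l-1}$ with $\mathsf w^j$ empty, $J_\alpha(n_1\|\mathsf w^1\|n_2\|\mathsf w^2\|\cdots\|\mathsf w^{l-1}\|n_l)\equiv0\pmod{I_{\mathrm B}}$.
   Context: $\mathcal U=\mathbb Z\langle u_1,\dots,u_N\rangle$, $\mathbf u_{\mathsf w}=u_{\mathsf w_1}\cdots u_{\mathsf w_n}$ (and $\mathbf u_{\mathsf w}=1$ for the empty word); $[m]=\{1,\dots,m\}$, $[0]=\varnothing$. $e_k(\mathbf u_S)=\sum_{i_1>\cdots>i_k,\,i_j\in S}u_{i_1}\cdots u_{i_k}$, $e_0=1$, $e_k=0$ for $k<0$ or $k>|S|$. $I_{\mathrm B}$ is the two-sided ideal generated by $u_b^2u_a+u_au_bu_a-u_bu_au_b-u_bu_a^2$ ($a<b$), $u_bu_cu_a-u_bu_au_c$ ($a<b<c$), $u_au_cu_b-u_cu_au_b$ ($a<b<c$). $J_\alpha(\mathbf n)=\sum_{\pi\in S_l}\mathrm{sgn}(\pi)\prod_{i=1}^{l}e_{\alpha_i+\pi(i)-i}(\mathbf u_{[n_i]})$ (left to right), and the augmented version is $J_\alpha(n_1\|\mathsf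 w^1\|n_2\|\cdots\|\mathsf w^{l-1}\|n_l)=\sum_{\pi\in S_l}\mathrm{sgn}(\pi)\,e_{\alpha_1+\pi(1)-1}(\mathbf u_{[n_1]})\mathbf u_{\mathsf w^1}e_{\alpha_2+\pi(2)-2}(\mathbf u_{[n_2]})\mathbf u_{\mathsf w^2}\cdots\mathbf u_{\mathsf w^{l-1}}e_{\alpha_l+\pi(l)-l}(\mathbf u_{[n_l]})$. -}

module Defs where

open import Data.Nat as ℕ using (ℕ; zero; suc; _<ᵇ_)
open import Data.Integer as ℤ using (ℤ; +_; -[1+_]; 1ℤ; 0ℤ)
open import Data.Fin as Fin using (Fin; toℕ; inject₁)
open import Data.List as List using (List; []; _∷_; _++_; map; concatMap; filter; reverse; allFin; foldr)
open import Data.List.Properties using (≡-dec)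
open import Data.Product using (_×_; _,_; Σ; ∃)
open import Data.Bool using (Bool; true; false; _∧_; if_then_else_)
open import Relation.Nullary using (does)
open import Relation.Binary.PropositionalEquality using (_≡_)

-- Letters: i : Fin N stands for the generator u_{toℕ i + 1}.
Word : ℕ → Set
Word N = List (Fin N)

-- Elements of ℤ⟨u_1,…,u_N⟩ as formal ℤ-linear combinations of words
-- (a list of terms c·u_w, understood as their sum).
Poly : ℕ → Set
Poly N = List (ℤ × Word N)

module _ {N : ℕ} where

  coeff : Poly N → Word N → ℤ
  coeff [] w = 0ℤ
  coeff ((c , v) ∷ p) w with does (≡-dec Fin._≟_ v w)
  ... | true  = c ℤ.+ coeff p w
  ... | false = coeff p w

  _≐_ : Poly N → Poly N → Set
  p ≐ q = ∀ w → coeff p w ≡ coeff q w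

  one : Poly N
  one = (1ℤ , []) ∷ []

  mono : Word N → Poly N
  mono w = (1ℤ , w) ∷ []

  infixr 6 _⊕_
  infixl 7 _⊗_
  infix 8 ⊖_
  _⊕_ : Poly N → Poly N → Poly N
  p ⊕ q = p ++ q

  scale : ℤ → Poly N → Poly N
  scale c = map (λ { (d , v) → (c ℤ.* d , v) })

  _⊗_ : Poly N → Poly N → Poly N
  p ⊗ q = concatMap (λ { (c , v) → map (λ { (d , w) → (c ℤ.* d , v ++ w) }) q }) p

  ⊖_ : Poly N → Poly N
  ⊖ p = scale (-[1+ 0 ]) p

  _<F_ : Fin N → Fin N → Set
  a <F b = toℕ a ℕ.< toℕ b

  data IsGenB : Poly N → Set where
    genB1 : ∀ a b → a <F b →
      IsGenB (mono (b ∷ b ∷ a ∷ []) ⊕ (mono (a ∷ b ∷ a ∷ []) ⊕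
              (⊖ mono (b ∷ a ∷ b ∷ []) ⊕ ⊖ mono (b ∷ a ∷ a ∷ []))))
    genB2 : ∀ a b c → a <F b → b <F c →
      IsGenB (mono (b ∷ c ∷ a ∷ []) ⊕ ⊖ mono (b ∷ a ∷ c ∷ []))
    genB3 : ∀ a b c → a <F b → b <F c →
      IsGenB (mono (a ∷ c ∷ b ∷ []) ⊕ ⊖ mono (c ∷ a ∷ b ∷ []))

  data InIB : Poly N → Set where
    inGen  : ∀ {g} → IsGenB g → InIB g
    inZero : InIB []
    inAdd  : ∀ {p q} → InIB p → InIB q → InIB (p ⊕ q)
    inScale : ∀ c {p} → InIB p → InIB (scale c p)
    inMulL : ∀ (r : Poly N) {p} → InIB p → InIB (r ⊗ p)
    inMulR : ∀ {p} (r : Poly N) → InIB p → InIB (p ⊗ r)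
    inResp : ∀ {p q} → p ≐ q → InIB p → InIB q

  _≡B_ : Poly N → Poly N → Set
  p ≡B q = InIB (p ⊕ ⊖ q)

  lettersBelow : ℕ → List (Fin N)
  lettersBelow m = filter (λ i → toℕ i ℕ.<? m) (reverse (allFin N))

  -- e_k of a list of letters given in decreasing order: sum of products
  -- u_{i_1}⋯u_{i_k} over i_1 > ⋯ > i_k
  eList : ℕ → List (Fin N) → Poly N
  eList zero    _        = one
  eList (suc k) []       = []
  eList (suc k) (x ∷ xs) = (mono (x ∷ []) ⊗ eList k xs) ⊕ eList (suc k) xs

  e : ℤ → ℕ → Poly N
  e (+ k)    m = eList k (lettersBelow m)
  e -[1+ _ ] m = []

allMaps : (n m : ℕ) → List (Fin n → Fin m)
allMaps zero    m = (λ ()) ∷ []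
allMaps (suc n) m =
  concatMap (λ f → map (λ x → λ { Fin.zero → x ; (Fin.suc i) → f i }) (allFin m)) (allMaps n m)

pairs : (n : ℕ) → List (Fin n × Fin n)
pairs n = concatMap (λ i → map (λ j → (i , j)) (filter (λ j → toℕ i ℕ.<? toℕ j) (allFin n))) (allFin n)

isPerm : {n : ℕ} → (Fin n → Fin n) → Bool
isPerm {n} f = foldr (λ { (i , j) b → (Data.Bool.not (does (f i Fin.≟ f j))) ∧ b }) true (pairs n)

Sym : (n : ℕ) → List (Fin n → Fin n)
Sym n = filter (λ f → Data.Bool.T? (isPerm f)) (allMaps n n)

inversions : {n : ℕ} → (Fin n → Fin n) → ℕ
inversions {n} f = List.length (filter (λ { (i , j) → toℕ (f j) ℕ.<? toℕ (f i) }) (pairs n))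

sgn : {n : ℕ} → (Fin n → Fin n) → ℤ
sgn f = (-[1+ 0 ]) ℤ.^ inversions f

module _ {N : ℕ} where

  prodAug : (m : ℕ) → (Fin (suc m) → Poly N) → (Fin m → Word N) → Poly N
  prodAug zero    F w = F Fin.zero
  prodAug (suc m) F w = (F Fin.zero ⊗ mono (w Fin.zero)) ⊗ prodAug m (λ i → F (Fin.suc i)) (λ i → w (Fin.suc i))

  prodL : (l : ℕ) → (Fin l → Poly N) → Poly N
  prodL zero    F = one
  prodL (suc l) F = F Fin.zero ⊗ prodL l (λ i → F (Fin.suc i))

  sumL : List (Poly N) → Poly N
  sumL = foldr _⊕_ []

  -- index α_i + π(i) − i  (0-based indices give the same difference)
  idx : {l : ℕ} → (Fin l → ℕ) → (Fin l → Fin l) → Fin l → ℤ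
  idx α π i = (+ α i ℤ.+ + toℕ (π i)) ℤ.- + toℕ i

  J : (l : ℕ) → (Fin l → ℕ) → (Fin l → Fin (suc N)) → Poly N
  J l α n = sumL (map (λ π → scale (sgn π) (prodL l (λ i → e (idx α π i) (toℕ (n i))))) (Sym l))

  -- J_α(n_1 ‖ w^1 ‖ n_2 ‖ ⋯ ‖ w^{l-1} ‖ n_l), with l = m + 1
  Jaug : (m : ℕ) → (Fin (suc m) → ℕ) → (Fin (suc m) → Fin (suc N)) → (Fin m → Word N) → Poly N
  Jaug m α n w = sumL (map (λ π → scale (sgn π) (prodAug m (λ i → e (idx α π i) (toℕ (n i))) w)) (Sym (suc m)))

-- Modulo I_B the elementary polynomials e_k(u_[m]) commute pairwise. To see this, consider
-- E(z) = (1 + z u_m) ⋯ (1 + z u_1) in (U/I_B)[[t]][[s]] and show E(s) E(t) = E(t) E(s) by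
-- induction on the alphabet, removing its largest letter x and smallest letter y at once: the
-- relations of I_B say that d = u_y u_x − u_x u_y is killed on both sides by every letter strictly
-- between y and x and that u_x d = d u_y, and since the product P(z) over the inner letters is
-- invertible as a power series, the induction hypotheses for x ∷ M, M ∷ʳ y and M combine.
-- In J_α the factors at positions j and j+1 are e_{α_j+π(j)−j} and e_{α_j+π(j+1)−j} of the same
-- alphabet, so composing π with the transposition (j j+1) swaps them and flips the sign: the
-- terms cancel in pairs. An empty word w^j keeps the two factors adjacent, and J_α is the case
-- of all words empty.

module Submission where

open import Level using (Level; 0ℓ)
open import Algebra.Bundles using (Ring; CommutativeMonoid)
open import Algebra.Morphism.Bundles using (RingHomomorphism)
import Algebra.Morphism.Construct.Composition as Composition
import Algebra.Morphism.Construct.Identity as Identity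
open import Data.Bool using (Bool; true; false; _∧_; not; if_then_else_; T?)
import Data.Bool.Properties as Bool
open import Data.Empty using (⊥-elim)
open import Data.Fin as Fin using (Fin; toℕ; inject₁)
import Data.Fin.Properties as Fin
open import Data.Integer as ℤ using (ℤ; +_; -[1+_]; 1ℤ)
import Data.Integer.Properties as ℤ
open import Data.Integer.Tactic.RingSolver using (solve-∀)
open import Data.List as List
  using (List; []; _∷_; _++_; _∷ʳ_; [_]; _∷ʳ′_; map; concatMap; filter; allFin; foldr; tabulate; reverse)
open import Data.List.Properties as List
  using (≡-dec; map-++; ++-assoc; ++-identityʳ; concatMap-++; length-++; map-∘; map-tabulate; unfold-reverse)
open import Data.List.Relation.Unary.All as All using (All; []; _∷_)
import Data.List.Relation.Unary.All.Properties as All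
open import Data.List.Relation.Unary.AllPairs using (AllPairs; []; _∷_)
import Data.List.Relation.Unary.AllPairs.Properties as AllPairs
open import Data.Nat as ℕ using (ℕ; zero; suc; s≤s)
import Data.Nat.Properties as ℕ
open import Data.Product using (_×_; _,_; proj₁; proj₂)
open import Function using (flip)
open import Relation.Binary.PropositionalEquality as ≡ using (_≡_; _≢_)
import Relation.Binary.Reasoning.Setoid as SetoidReasoning
open import Relation.Nullary using (Dec; yes; no; does)
open import Relation.Nullary.Decidable using (dec-true)
open import Relation.Unary using (Pred; Decidable)

open import Defs


module _ {N : ℕ} where

  coeff-++ : (p q : Poly N) (w : Word N) → coeff (p ⊕ q) w ≡ coeff p w ℤ.+ coeff q w
  coeff-++ [] q w = ≡.sym (ℤ.+-identityˡ _)
  coeff-++ ((c , v) ∷ p) q w with does (≡-dec Fin._≟_ v w)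
  ... | true  = ≡.trans (≡.cong (ℤ._+_ c) (coeff-++ p q w)) (≡.sym (ℤ.+-assoc c _ _))
  ... | false = coeff-++ p q w

  coeff-scale : (c : ℤ) (p : Poly N) (w : Word N) → coeff (scale c p) w ≡ c ℤ.* coeff p w
  coeff-scale c [] w = ≡.sym (ℤ.*-zeroʳ c)
  coeff-scale c ((d , v) ∷ p) w with does (≡-dec Fin._≟_ v w)
  ... | true  = ≡.trans (≡.cong (ℤ._+_ (c ℤ.* d)) (coeff-scale c p w)) (≡.sym (ℤ.*-distribˡ-+ c d _))
  ... | false = coeff-scale c p w

  coeff-⊖ : (p : Poly N) (w : Word N) → coeff (⊖ p) w ≡ ℤ.- coeff p w
  coeff-⊖ p w = ≡.trans (coeff-scale -[1+ 0 ] p w) (ℤ.-1*i≡-i _)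

  coeff-minus : (p q : Poly N) (w : Word N) → coeff (p ⊕ ⊖ q) w ≡ coeff p w ℤ.- coeff q w
  coeff-minus p q w = ≡.trans (coeff-++ p (⊖ q) w) (≡.cong (ℤ._+_ (coeff p w)) (coeff-⊖ q w))

  coeff-swap : ∀ x y (r : Poly N) → (x ∷ y ∷ r) ≐ (y ∷ x ∷ r)
  coeff-swap x y r w = begin
      coeff (x ∷ y ∷ r) w
    ≡⟨ ≡.trans (coeff-++ (x ∷ []) (y ∷ r) w) (≡.cong (ℤ._+_ (coeff (x ∷ []) w)) (coeff-++ (y ∷ []) r w)) ⟩
      coeff (x ∷ []) w ℤ.+ (coeff (y ∷ []) w ℤ.+ coeff r w)
    ≡⟨ swap-first (coeff (x ∷ []) w) (coeff (y ∷ []) w) (coeff r w) ⟩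
      coeff (y ∷ []) w ℤ.+ (coeff (x ∷ []) w ℤ.+ coeff r w)
    ≡⟨ ≡.sym (≡.trans (coeff-++ (y ∷ []) (x ∷ r) w) (≡.cong (ℤ._+_ (coeff (y ∷ []) w)) (coeff-++ (x ∷ []) r w))) ⟩
      coeff (y ∷ x ∷ r) w
    ∎
    where
    open ≡.≡-Reasoning
    swap-first : ∀ a b c → a ℤ.+ (b ℤ.+ c) ≡.≡ b ℤ.+ (a ℤ.+ c)
    swap-first = solve-∀

  coeff-∷-cong : ∀ x {r r′ : Poly N} → r ≐ r′ → (x ∷ r) ≐ (x ∷ r′)
  coeff-∷-cong x {r} {r′} r≐r′ w =
    ≡.trans (coeff-++ (x ∷ []) r w) (≡.trans (≡.cong (ℤ._+_ (coeff (x ∷ []) w)) (r≐r′ w)) (≡.sym (coeff-++ (x ∷ []) r′ w)))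

  ⊗-distribʳ : (p q r : Poly N) → (p ⊕ q) ⊗ r ≡ p ⊗ r ⊕ q ⊗ r
  ⊗-distribʳ p q r = concatMap-++ _ p q

  ⊗-distribˡ : (p q r : Poly N) → (p ⊗ (q ⊕ r)) ≐ (p ⊗ q ⊕ p ⊗ r)
  ⊗-distribˡ [] q r w = ≡.refl
  ⊗-distribˡ ((c , v) ∷ p) q r w = begin
      coeff (map f (q ++ r) ++ p ⊗ (q ⊕ r)) w
    ≡⟨ coeff-++ (map f (q ++ r)) _ w ⟩
      coeff (map f (q ++ r)) w ℤ.+ coeff (p ⊗ (q ⊕ r)) w
    ≡⟨ ≡.cong₂ ℤ._+_ (≡.trans (≡.cong (λ z → coeff z w) (map-++ f q r)) (coeff-++ (map f q) (map f r) w))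
                   (≡.trans (⊗-distribˡ p q r w) (coeff-++ (p ⊗ q) (p ⊗ r) w)) ⟩
      (coeff (map f q) w ℤ.+ coeff (map f r) w) ℤ.+ (coeff (p ⊗ q) w ℤ.+ coeff (p ⊗ r) w)
    ≡⟨ interchange (coeff (map f q) w) (coeff (map f r) w) (coeff (p ⊗ q) w) (coeff (p ⊗ r) w) ⟩
      (coeff (map f q) w ℤ.+ coeff (p ⊗ q) w) ℤ.+ (coeff (map f r) w ℤ.+ coeff (p ⊗ r) w)
    ≡⟨ ≡.sym (≡.cong₂ ℤ._+_ (coeff-++ (map f q) (p ⊗ q) w) (coeff-++ (map f r) (p ⊗ r) w)) ⟩
      coeff (map f q ++ p ⊗ q) w ℤ.+ coeff (map f r ++ p ⊗ r) w
    ≡⟨ ≡.sym (coeff-++ (map f q ++ p ⊗ q) _ w) ⟩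
      coeff ((map f q ++ p ⊗ q) ++ (map f r ++ p ⊗ r)) w
    ∎
    where
    open ≡.≡-Reasoning
    f : ℤ × Word N → ℤ × Word N
    f (d , u) = c ℤ.* d , v ++ u
    interchange : ∀ a b c d → (a ℤ.+ b) ℤ.+ (c ℤ.+ d) ≡ (a ℤ.+ c) ℤ.+ (b ℤ.+ d)
    interchange = solve-∀

  ⊗-scaleˡ : (c : ℤ) (p q : Poly N) → scale c p ⊗ q ≡ scale c (p ⊗ q)
  ⊗-scaleˡ c [] q = ≡.refl
  ⊗-scaleˡ c ((d , v) ∷ p) q = ≡.trans (≡.cong₂ _++_ (row q) (⊗-scaleˡ c p q)) (≡.sym (map-++ _ (map _ q) (p ⊗ q)))
    where
    row : (q : Poly N) → map (λ { (e , u) → (c ℤ.* d ℤ.* e , v ++ u) }) q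
                       ≡ scale c (map (λ { (e , u) → (d ℤ.* e , v ++ u) }) q)
    row [] = ≡.refl
    row ((e , u) ∷ q) = ≡.cong₂ _∷_ (≡.cong (_, v ++ u) (ℤ.*-assoc c d e)) (row q)

  ⊗-scaleʳ : (c : ℤ) (p q : Poly N) → p ⊗ scale c q ≡ scale c (p ⊗ q)
  ⊗-scaleʳ c [] q = ≡.refl
  ⊗-scaleʳ c ((d , v) ∷ p) q = ≡.trans (≡.cong₂ _++_ (row q) (⊗-scaleʳ c p q)) (≡.sym (map-++ _ (map _ q) (p ⊗ q)))
    where
    row : (q : Poly N) → map (λ { (e , u) → (d ℤ.* e , v ++ u) }) (scale c q)
                       ≡ scale c (map (λ { (e , u) → (d ℤ.* e , v ++ u) }) q)
    row [] = ≡.refl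
    row ((e , u) ∷ q) = ≡.cong₂ _∷_ (≡.cong (_, v ++ u) (*-swapˡ d c e)) (row q)
      where
      *-swapˡ : ∀ a b c → a ℤ.* (b ℤ.* c) ≡ b ℤ.* (a ℤ.* c)
      *-swapˡ = solve-∀

  ⊗-assoc : (p q r : Poly N) → (p ⊗ q) ⊗ r ≡ p ⊗ (q ⊗ r)
  ⊗-assoc [] q r = ≡.refl
  ⊗-assoc ((c , v) ∷ p) q r = ≡.trans (⊗-distribʳ (map _ q) (p ⊗ q) r) (≡.cong₂ _++_ (prefix-⊗ q) (⊗-assoc p q r))
    where
    prefix : ℤ × Word N → ℤ × Word N
    prefix (d , u) = c ℤ.* d , v ++ u
    prefix-⊗ : (q : Poly N) → map prefix q ⊗ r ≡ map prefix (q ⊗ r)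
    prefix-⊗ [] = ≡.refl
    prefix-⊗ ((d , u) ∷ q) = ≡.trans (≡.cong₂ _++_ (row r) (prefix-⊗ q)) (≡.sym (map-++ prefix (map _ r) (q ⊗ r)))
      where
      row : (r : Poly N) → map (λ { (e , x) → (c ℤ.* d ℤ.* e , (v ++ u) ++ x) }) r
                         ≡ map prefix (map (λ { (e , x) → (d ℤ.* e , u ++ x) }) r)
      row [] = ≡.refl
      row ((e , x) ∷ r) = ≡.cong₂ _∷_ (≡.cong₂ _,_ (ℤ.*-assoc c d e) (++-assoc v u x)) (row r)

  ⊗-identityˡ : (p : Poly N) → one ⊗ p ≡ p
  ⊗-identityˡ p = ≡.trans (++-identityʳ _) (row p)
    where
    row : (p : Poly N) → map (λ { (e , u) → (1ℤ ℤ.* e , [] ++ u) }) p ≡ p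
    row [] = ≡.refl
    row ((e , u) ∷ p) = ≡.cong₂ _∷_ (≡.cong (_, u) (ℤ.*-identityˡ e)) (row p)

  ⊗-identityʳ : (p : Poly N) → p ⊗ one ≡ p
  ⊗-identityʳ [] = ≡.refl
  ⊗-identityʳ ((c , v) ∷ p) = ≡.cong₂ _∷_ (≡.cong₂ _,_ (ℤ.*-identityʳ c) (++-identityʳ v)) (⊗-identityʳ p)

  ⊗-zeroʳ : (p : Poly N) → p ⊗ [] ≡ []
  ⊗-zeroʳ [] = ≡.refl
  ⊗-zeroʳ (_ ∷ p) = ⊗-zeroʳ p

  -- A record rather than _≡B_ itself, so that p and q can be inferred from a proof.
  infix 4 _≈ᴮ_
  record _≈ᴮ_ (p q : Poly N) : Set where
    constructor mk≈ᴮ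
    field inIdeal : p ≡B q
  open _≈ᴮ_ public

  ≈ᴮ-byIdeal : ∀ {r p q} → InIB r → (∀ w → coeff r w ≡ coeff p w ℤ.- coeff q w) → p ≈ᴮ q
  ≈ᴮ-byIdeal {r} {p} {q} r∈I h = mk≈ᴮ (inResp (λ w → ≡.trans (h w) (≡.sym (coeff-minus p q w))) r∈I)

  ≐⇒≈ᴮ : {p q : Poly N} → p ≐ q → p ≈ᴮ q
  ≐⇒≈ᴮ {p} {q} p≐q = ≈ᴮ-byIdeal inZero λ w → ≡.sym (≡.trans (≡.cong (ℤ._- coeff q w) (p≐q w)) (ℤ.+-inverseʳ (coeff q w)))

  ≡⇒≈ᴮ : {p q : Poly N} → p ≡ q → p ≈ᴮ q
  ≡⇒≈ᴮ ≡.refl = ≐⇒≈ᴮ λ _ → ≡.refl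

  ≈ᴮ-sym : {p q : Poly N} → p ≈ᴮ q → q ≈ᴮ p
  ≈ᴮ-sym {p} {q} (mk≈ᴮ h) = ≈ᴮ-byIdeal (inScale -[1+ 0 ] h) λ w →
    ≡.trans (coeff-scale -[1+ 0 ] (p ⊕ ⊖ q) w) (≡.trans (≡.cong (ℤ._*_ -[1+ 0 ]) (coeff-minus p q w)) (negate-minus (coeff p w) (coeff q w)))
    where
    negate-minus : ∀ a b → -[1+ 0 ] ℤ.* (a ℤ.- b) ≡ b ℤ.- a
    negate-minus = solve-∀

  ≈ᴮ-trans : {p q r : Poly N} → p ≈ᴮ q → q ≈ᴮ r → p ≈ᴮ r
  ≈ᴮ-trans {p} {q} {r} (mk≈ᴮ h) (mk≈ᴮ k) = ≈ᴮ-byIdeal (inAdd h k) λ w →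
    ≡.trans (coeff-++ (p ⊕ ⊖ q) _ w)
      (≡.trans (≡.cong₂ ℤ._+_ (coeff-minus p q w) (coeff-minus q r w)) (telescope (coeff p w) (coeff q w) (coeff r w)))
    where
    telescope : ∀ a b c → (a ℤ.- b) ℤ.+ (b ℤ.- c) ≡ a ℤ.- c
    telescope = solve-∀

  ⊕-cong : {p p′ q q′ : Poly N} → p ≈ᴮ p′ → q ≈ᴮ q′ → p ⊕ q ≈ᴮ p′ ⊕ q′
  ⊕-cong {p} {p′} {q} {q′} (mk≈ᴮ h) (mk≈ᴮ k) = ≈ᴮ-byIdeal (inAdd h k) λ w → begin
      coeff ((p ⊕ ⊖ p′) ⊕ (q ⊕ ⊖ q′)) w
    ≡⟨ ≡.trans (coeff-++ (p ⊕ ⊖ p′) _ w) (≡.cong₂ ℤ._+_ (coeff-minus p p′ w) (coeff-minus q q′ w)) ⟩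
      (coeff p w ℤ.- coeff p′ w) ℤ.+ (coeff q w ℤ.- coeff q′ w)
    ≡⟨ minus-interchange (coeff p w) (coeff p′ w) (coeff q w) (coeff q′ w) ⟩
      (coeff p w ℤ.+ coeff q w) ℤ.- (coeff p′ w ℤ.+ coeff q′ w)
    ≡⟨ ≡.sym (≡.cong₂ ℤ._-_ (coeff-++ p q w) (coeff-++ p′ q′ w)) ⟩
      coeff (p ⊕ q) w ℤ.- coeff (p′ ⊕ q′) w
    ∎
    where
    open ≡.≡-Reasoning
    minus-interchange : ∀ a b c d → (a ℤ.- b) ℤ.+ (c ℤ.- d) ≡ (a ℤ.+ c) ℤ.- (b ℤ.+ d)
    minus-interchange = solve-∀

  scale-cong : (c : ℤ) {p q : Poly N} → p ≈ᴮ q → scale c p ≈ᴮ scale c q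
  scale-cong c {p} {q} (mk≈ᴮ h) = ≈ᴮ-byIdeal (inScale c h) λ w → begin
      coeff (scale c (p ⊕ ⊖ q)) w
    ≡⟨ ≡.trans (coeff-scale c (p ⊕ ⊖ q) w) (≡.cong (ℤ._*_ c) (coeff-minus p q w)) ⟩
      c ℤ.* (coeff p w ℤ.- coeff q w)
    ≡⟨ *-distrib-minus c (coeff p w) (coeff q w) ⟩
      c ℤ.* coeff p w ℤ.- c ℤ.* coeff q w
    ≡⟨ ≡.sym (≡.cong₂ ℤ._-_ (coeff-scale c p w) (coeff-scale c q w)) ⟩
      coeff (scale c p) w ℤ.- coeff (scale c q) w
    ∎
    where
    open ≡.≡-Reasoning
    *-distrib-minus : ∀ c a b → c ℤ.* (a ℤ.- b) ≡ c ℤ.* a ℤ.- c ℤ.* b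
    *-distrib-minus = solve-∀

  ⊗-congˡ : {p p′ : Poly N} (r : Poly N) → p ≈ᴮ p′ → p ⊗ r ≈ᴮ p′ ⊗ r
  ⊗-congˡ {p} {p′} r (mk≈ᴮ h) = mk≈ᴮ (inResp (λ w → ≡.cong (λ z → coeff z w) distributed) (inMulR r h))
    where
    distributed : (p ⊕ ⊖ p′) ⊗ r ≡ p ⊗ r ⊕ ⊖ (p′ ⊗ r)
    distributed = ≡.trans (⊗-distribʳ p (⊖ p′) r) (≡.cong (p ⊗ r ++_) (⊗-scaleˡ -[1+ 0 ] p′ r))

  ⊗-congʳ : (r : Poly N) {p p′ : Poly N} → p ≈ᴮ p′ → r ⊗ p ≈ᴮ r ⊗ p′
  ⊗-congʳ r {p} {p′} (mk≈ᴮ h) = mk≈ᴮ (inResp distributed (inMulL r h))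
    where
    distributed : (r ⊗ (p ⊕ ⊖ p′)) ≐ (r ⊗ p ⊕ ⊖ (r ⊗ p′))
    distributed w = ≡.trans (⊗-distribˡ r p (⊖ p′) w) (≡.cong (λ z → coeff (r ⊗ p ++ z) w) (⊗-scaleʳ -[1+ 0 ] r p′))

  ⊗-cong : {p p′ q q′ : Poly N} → p ≈ᴮ p′ → q ≈ᴮ q′ → p ⊗ q ≈ᴮ p′ ⊗ q′
  ⊗-cong {p′ = p′} {q = q} h k = ≈ᴮ-trans (⊗-congˡ q h) (⊗-congʳ p′ k)

  ⊕-comm : (p q : Poly N) → p ⊕ q ≈ᴮ q ⊕ p
  ⊕-comm p q = ≐⇒≈ᴮ λ w → ≡.trans (coeff-++ p q w) (≡.trans (ℤ.+-comm (coeff p w) (coeff q w)) (≡.sym (coeff-++ q p w)))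

  ⊕-inverseʳ : (p : Poly N) → p ⊕ ⊖ p ≈ᴮ []
  ⊕-inverseʳ p = ≐⇒≈ᴮ λ w → ≡.trans (coeff-minus p p w) (ℤ.+-inverseʳ (coeff p w))

  scale-cancel : ∀ c (p : Poly N) → scale c p ⊕ scale (ℤ.- c) p ≈ᴮ []
  scale-cancel c p = ≐⇒≈ᴮ λ w → ≡.trans (coeff-++ (scale c p) _ w)
    (≡.trans (≡.cong₂ ℤ._+_ (coeff-scale c p w) (coeff-scale (ℤ.- c) p w)) (cancel c (coeff p w)))
    where
    cancel : ∀ c x → c ℤ.* x ℤ.+ (ℤ.- c) ℤ.* x ≡ ℤ.0ℤ
    cancel = solve-∀

quotientRing : ℕ → Ring 0ℓ 0ℓ
quotientRing N = record
  { Carrier = Poly N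
  ; _≈_ = _≈ᴮ_
  ; _+_ = _⊕_
  ; _*_ = _⊗_
  ; -_ = ⊖_
  ; 0# = []
  ; 1# = one
  ; isRing = record
    { +-isAbelianGroup = record
      { isGroup = record
        { isMonoid = record
          { isSemigroup = record
            { isMagma = record
              { isEquivalence = record { refl = ≡⇒≈ᴮ ≡.refl ; sym = ≈ᴮ-sym ; trans = ≈ᴮ-trans }
              ; ∙-cong = ⊕-cong }
            ; assoc = λ p q r → ≡⇒≈ᴮ (++-assoc p q r) }
          ; identity = (λ p → ≡⇒≈ᴮ ≡.refl) , (λ p → ≡⇒≈ᴮ (++-identityʳ p)) }
        ; inverse = (λ p → ≈ᴮ-trans (⊕-comm (⊖ p) p) (⊕-inverseʳ p)) , ⊕-inverseʳ
        ; ⁻¹-cong = scale-cong -[1+ 0 ] }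
      ; comm = ⊕-comm }
    ; *-cong = ⊗-cong
    ; *-assoc = λ p q r → ≡⇒≈ᴮ (⊗-assoc p q r)
    ; *-identity = (λ p → ≡⇒≈ᴮ (⊗-identityˡ p)) , (λ p → ≡⇒≈ᴮ (⊗-identityʳ p))
    ; distrib = (λ p q r → ≐⇒≈ᴮ (⊗-distribˡ p q r)) , (λ r p q → ≡⇒≈ᴮ (⊗-distribʳ p q r))
    }
  }

module PowerSeries {c ℓ : Level} (R : Ring c ℓ) where

  open Ring R
  open SetoidReasoning setoid
  open import Algebra.Properties.CommutativeSemigroup +-commutativeSemigroup using (interchange)
  open import Algebra.Properties.Ring R using (-0#≈0#)

  Series : Set c
  Series = ℕ → Carrier

  infix 4 _≋_
  _≋_ : Series → Series → Set ℓ
  f ≋ g = ∀ n → f n ≈ g n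

  infixl 6 _⊞_
  infixl 7 _⊠_
  infix 8 ⊟_
  _⊞_ : Series → Series → Series
  (f ⊞ g) n = f n + g n

  ⊟_ : Series → Series
  (⊟ f) n = - f n

  tail : Series → Series
  tail f n = f (suc n)

  _⊠_ : Series → Series → Series
  (f ⊠ g) zero    = f 0 * g 0
  (f ⊠ g) (suc n) = f 0 * g (suc n) + (tail f ⊠ g) n

  const : Carrier → Series
  const a zero    = a
  const a (suc n) = 0#

  𝟘 𝟙 X : Series
  𝟘 n = 0#
  𝟙 = const 1#
  X zero          = 0#
  X (suc zero)    = 1#
  X (suc (suc n)) = 0#

  shift : Series → Series
  shift f zero    = 0#
  shift f (suc n) = f n

  ⊠-cong : ∀ {f f′ g g′} → f ≋ f′ → g ≋ g′ → f ⊠ g ≋ f′ ⊠ g′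
  ⊠-cong f≋f′ g≋g′ zero    = *-cong (f≋f′ 0) (g≋g′ 0)
  ⊠-cong f≋f′ g≋g′ (suc n) = +-cong (*-cong (f≋f′ 0) (g≋g′ (suc n))) (⊠-cong (λ k → f≋f′ (suc k)) g≋g′ n)

  ⊠-distribʳ : ∀ f g h → (f ⊞ g) ⊠ h ≋ (f ⊠ h) ⊞ (g ⊠ h)
  ⊠-distribʳ f g h zero    = distribʳ (h 0) (f 0) (g 0)
  ⊠-distribʳ f g h (suc n) =
    trans (+-cong (distribʳ (h (suc n)) (f 0) (g 0)) (⊠-distribʳ (tail f) (tail g) h n)) (interchange _ _ _ _)

  ⊠-distribˡ : ∀ f g h → f ⊠ (g ⊞ h) ≋ (f ⊠ g) ⊞ (f ⊠ h)
  ⊠-distribˡ f g h zero    = distribˡ (f 0) (g 0) (h 0)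
  ⊠-distribˡ f g h (suc n) =
    trans (+-cong (distribˡ (f 0) (g (suc n)) (h (suc n))) (⊠-distribˡ (tail f) g h n)) (interchange _ _ _ _)

  ⊠-scaleˡ : ∀ a f g → (λ k → a * f k) ⊠ g ≋ (λ k → a * (f ⊠ g) k)
  ⊠-scaleˡ a f g zero    = *-assoc _ _ _
  ⊠-scaleˡ a f g (suc n) =
    trans (+-cong (*-assoc _ _ _) (⊠-scaleˡ a (tail f) g n)) (sym (distribˡ _ _ _))

  ⊠-assoc : ∀ f g h → (f ⊠ g) ⊠ h ≋ f ⊠ (g ⊠ h)
  ⊠-assoc f g h zero    = *-assoc _ _ _
  ⊠-assoc f g h (suc n) = begin
      f 0 * g 0 * h (suc n) + (tail (f ⊠ g) ⊠ h) n
    ≈⟨ +-congˡ (⊠-distribʳ (λ k → f 0 * g (suc k)) (tail f ⊠ g) h n) ⟩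
      f 0 * g 0 * h (suc n) + (((λ k → f 0 * g (suc k)) ⊠ h) n + ((tail f ⊠ g) ⊠ h) n)
    ≈⟨ +-cong (*-assoc _ _ _) (+-cong (⊠-scaleˡ (f 0) (tail g) h n) (⊠-assoc (tail f) g h n)) ⟩
      f 0 * (g 0 * h (suc n)) + (f 0 * (tail g ⊠ h) n + (tail f ⊠ (g ⊠ h)) n)
    ≈⟨ trans (sym (+-assoc _ _ _)) (+-congʳ (sym (distribˡ _ _ _))) ⟩
      f 0 * (g ⊠ h) (suc n) + (tail f ⊠ (g ⊠ h)) n
    ∎

  ⊠-zeroˡ : ∀ g → 𝟘 ⊠ g ≋ 𝟘
  ⊠-zeroˡ g zero    = zeroˡ _
  ⊠-zeroˡ g (suc n) = trans (+-cong (zeroˡ _) (⊠-zeroˡ g n)) (+-identityˡ _)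

  ⊠-constˡ : ∀ a g → const a ⊠ g ≋ (λ n → a * g n)
  ⊠-constˡ a g zero    = refl
  ⊠-constˡ a g (suc n) = trans (+-congˡ (⊠-zeroˡ g n)) (+-identityʳ _)

  ⊠-constʳ : ∀ f a → f ⊠ const a ≋ (λ n → f n * a)
  ⊠-constʳ f a zero    = refl
  ⊠-constʳ f a (suc n) = trans (+-cong (zeroʳ _) (⊠-constʳ (tail f) a n)) (+-identityˡ _)

  ⊠-identityˡ : ∀ g → 𝟙 ⊠ g ≋ g
  ⊠-identityˡ g n = trans (⊠-constˡ 1# g n) (*-identityˡ _)

  ⊠-identityʳ : ∀ f → f ⊠ 𝟙 ≋ f
  ⊠-identityʳ f n = trans (⊠-constʳ f 1# n) (*-identityʳ _)

  powerSeriesRing : Ring c ℓ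
  powerSeriesRing = record
    { Carrier = Series
    ; _≈_ = _≋_
    ; _+_ = _⊞_
    ; _*_ = _⊠_
    ; -_ = ⊟_
    ; 0# = 𝟘
    ; 1# = 𝟙
    ; isRing = record
      { +-isAbelianGroup = record
        { isGroup = record
          { isMonoid = record
            { isSemigroup = record
              { isMagma = record
                { isEquivalence = record
                  { refl = λ n → refl ; sym = λ e n → sym (e n) ; trans = λ e e′ n → trans (e n) (e′ n) }
                ; ∙-cong = λ e e′ n → +-cong (e n) (e′ n) }
              ; assoc = λ f g h n → +-assoc _ _ _ }
            ; identity = (λ f n → +-identityˡ _) , (λ f n → +-identityʳ _) }
          ; inverse = (λ f n → -‿inverseˡ _) , (λ f n → -‿inverseʳ _)
          ; ⁻¹-cong = λ e n → -‿cong (e n) }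
        ; comm = λ f g n → +-comm _ _ }
      ; *-cong = ⊠-cong
      ; *-assoc = ⊠-assoc
      ; *-identity = ⊠-identityˡ , ⊠-identityʳ
      ; distrib = ⊠-distribˡ , (λ h f g → ⊠-distribʳ f g h)
      }
    }

  constHomomorphism : RingHomomorphism (Ring.rawRing R) (Ring.rawRing powerSeriesRing)
  constHomomorphism = record
    { ⟦_⟧ = const
    ; isRingHomomorphism = record
      { isSemiringHomomorphism = record
        { isNearSemiringHomomorphism = record
          { +-isMonoidHomomorphism = record
            { isMagmaHomomorphism = record
              { isRelHomomorphism = record { cong = λ { a≈b zero → a≈b ; a≈b (suc n) → refl } }
              ; homo = λ { a b zero → refl ; a b (suc n) → sym (+-identityʳ _) } }
            ; ε-homo = λ { zero → refl ; (suc n) → refl } }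
          ; *-homo = λ a b n → sym (trans (⊠-constˡ a (const b) n) (const-scale a b n)) }
        ; 1#-homo = λ { zero → refl ; (suc n) → refl } }
      ; -‿homo = λ { a zero → refl ; a (suc n) → sym -0#≈0# }
      }
    }
    where
    const-scale : ∀ a b n → a * const b n ≈ const (a * b) n
    const-scale a b zero    = refl
    const-scale a b (suc n) = zeroʳ _

  ⊠-Xˡ : ∀ g → X ⊠ g ≋ shift g
  ⊠-Xˡ g zero    = zeroˡ _
  ⊠-Xˡ g (suc n) = trans (+-cong (zeroˡ _) (trans (⊠-cong tail-X (λ k → refl) n) (⊠-identityˡ g n))) (+-identityˡ _)
    where
    tail-X : tail X ≋ 𝟙
    tail-X zero    = refl
    tail-X (suc k) = refl

  ⊠-Xʳ : ∀ f → f ⊠ X ≋ shift f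
  ⊠-Xʳ f zero          = zeroʳ _
  ⊠-Xʳ f (suc zero)    = trans (+-cong (*-identityʳ _) (⊠-Xʳ (tail f) 0)) (+-identityʳ _)
  ⊠-Xʳ f (suc (suc n)) = trans (+-cong (zeroʳ _) (⊠-Xʳ (tail f) (suc n))) (+-identityˡ _)

  X-central : ∀ g → X ⊠ g ≋ g ⊠ X
  X-central g n = trans (⊠-Xˡ g n) (sym (⊠-Xʳ g n))

  const-central : ∀ a → (∀ b → a * b ≈ b * a) → ∀ g → const a ⊠ g ≋ g ⊠ const a
  const-central a a-central g n = trans (⊠-constˡ a g n) (trans (a-central _) (sym (⊠-constʳ g a n)))

  1+Xa⊠ : ∀ a g → (𝟙 ⊞ X ⊠ const a) ⊠ g ≋ (λ n → g n + shift (λ k → a * g k) n)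
  1+Xa⊠ a g n = begin
      ((𝟙 ⊞ X ⊠ const a) ⊠ g) n   ≈⟨ ⊠-distribʳ 𝟙 (X ⊠ const a) g n ⟩
      (𝟙 ⊠ g) n + ((X ⊠ const a) ⊠ g) n  ≈⟨ +-cong (⊠-identityˡ g n) (⊠-assoc X (const a) g n) ⟩
      g n + (X ⊠ (const a ⊠ g)) n  ≈⟨ +-congˡ (⊠-Xˡ _ n) ⟩
      g n + shift (const a ⊠ g) n  ≈⟨ +-congˡ (shift-cong n) ⟩
      g n + shift (λ k → a * g k) n ∎
    where
    shift-cong : shift (const a ⊠ g) ≋ shift (λ k → a * g k)
    shift-cong zero    = refl
    shift-cong (suc n) = ⊠-constˡ a g n

  ⊠1+Xa : ∀ a f → f ⊠ (𝟙 ⊞ X ⊠ const a) ≋ (λ n → f n + shift f n * a)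
  ⊠1+Xa a f n = begin
      (f ⊠ (𝟙 ⊞ X ⊠ const a)) n  ≈⟨ ⊠-distribˡ f 𝟙 (X ⊠ const a) n ⟩
      (f ⊠ 𝟙) n + (f ⊠ (X ⊠ const a)) n  ≈⟨ +-cong (⊠-identityʳ f n) (sym (⊠-assoc f X (const a) n)) ⟩
      f n + ((f ⊠ X) ⊠ const a) n  ≈⟨ +-congˡ (⊠-constʳ _ a n) ⟩
      f n + (f ⊠ X) n * a  ≈⟨ +-congˡ (*-congʳ (⊠-Xʳ f n)) ⟩
      f n + shift f n * a ∎

  -- Both are the series (-a)ⁿ; each recursion makes one of the two inverse laws immediate.
  inverseʳ-1+Xa inverseˡ-1+Xa : Carrier → Series
  inverseʳ-1+Xa a zero    = 1#
  inverseʳ-1+Xa a (suc n) = - (a * inverseʳ-1+Xa a n)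
  inverseˡ-1+Xa a zero    = 1#
  inverseˡ-1+Xa a (suc n) = - (inverseˡ-1+Xa a n * a)

  1+Xa-inverseʳ : ∀ a → (𝟙 ⊞ X ⊠ const a) ⊠ inverseʳ-1+Xa a ≋ 𝟙
  1+Xa-inverseʳ a zero    = trans (1+Xa⊠ a (inverseʳ-1+Xa a) 0) (+-identityʳ _)
  1+Xa-inverseʳ a (suc n) = trans (1+Xa⊠ a (inverseʳ-1+Xa a) (suc n)) (-‿inverseˡ _)

  1+Xa-inverseˡ : ∀ a → inverseˡ-1+Xa a ⊠ (𝟙 ⊞ X ⊠ const a) ≋ 𝟙
  1+Xa-inverseˡ a zero    = trans (⊠1+Xa a (inverseˡ-1+Xa a) 0) (trans (+-congˡ (zeroˡ _)) (+-identityʳ _))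
  1+Xa-inverseˡ a (suc n) = trans (⊠1+Xa a (inverseˡ-1+Xa a) (suc n)) (-‿inverseˡ _)

module RingElements {c ℓ : Level} (K : Ring c ℓ) where

  open Ring K
  open import Algebra.Definitions _≈_ using (Invertible)
  open SetoidReasoning setoid
  open import Algebra.Properties.CommutativeSemigroup +-commutativeSemigroup using (xy∙z≈xz∙y)

  Central : Carrier → Set _
  Central a = ∀ b → a * b ≈ b * a

  Central-* : ∀ {a b} → Central a → Central b → Central (a * b)
  Central-* {a} {b} a-central b-central z = begin
    a * b * z    ≈⟨ *-assoc _ _ _ ⟩
    a * (b * z)  ≈⟨ *-congˡ (b-central z) ⟩
    a * (z * b)  ≈⟨ sym (*-assoc _ _ _) ⟩
    a * z * b    ≈⟨ *-congʳ (a-central z) ⟩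
    z * a * b    ≈⟨ *-assoc _ _ _ ⟩
    z * (a * b)  ∎

  central-slide : ∀ {u} → Central u → ∀ a b → a * (u * b) ≈ u * (a * b)
  central-slide {u} u-central a b = begin
    a * (u * b)  ≈⟨ sym (*-assoc _ _ _) ⟩
    a * u * b    ≈⟨ *-congʳ (sym (u-central a)) ⟩
    u * a * b    ≈⟨ *-assoc _ _ _ ⟩
    u * (a * b)  ∎

  central-collect : ∀ {u v} → Central v → ∀ a b → u * a * (v * b) ≈ u * v * (a * b)
  central-collect {u} {v} v-central a b = begin
    u * a * (v * b)    ≈⟨ *-assoc _ _ _ ⟩
    u * (a * (v * b))  ≈⟨ *-congˡ (central-slide v-central a b) ⟩
    u * (v * (a * b))  ≈⟨ sym (*-assoc _ _ _) ⟩
    u * v * (a * b)    ∎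

  Invertible-1# : Invertible 1# _*_ 1#
  Invertible-1# = 1# , *-identityˡ 1# , *-identityˡ 1#

  Invertible-* : ∀ {a b} → Invertible 1# _*_ a → Invertible 1# _*_ b → Invertible 1# _*_ (a * b)
  Invertible-* {a} {b} (a⁻¹ , a⁻¹a≈1 , aa⁻¹≈1) (b⁻¹ , b⁻¹b≈1 , bb⁻¹≈1) = b⁻¹ * a⁻¹ , left , right
    where
    left : b⁻¹ * a⁻¹ * (a * b) ≈ 1#
    left = begin
      b⁻¹ * a⁻¹ * (a * b)    ≈⟨ *-assoc _ _ _ ⟩
      b⁻¹ * (a⁻¹ * (a * b))  ≈⟨ *-congˡ (sym (*-assoc _ _ _)) ⟩
      b⁻¹ * (a⁻¹ * a * b)    ≈⟨ *-congˡ (trans (*-congʳ a⁻¹a≈1) (*-identityˡ b)) ⟩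
      b⁻¹ * b                ≈⟨ b⁻¹b≈1 ⟩
      1#                     ∎
    right : a * b * (b⁻¹ * a⁻¹) ≈ 1#
    right = begin
      a * b * (b⁻¹ * a⁻¹)    ≈⟨ *-assoc _ _ _ ⟩
      a * (b * (b⁻¹ * a⁻¹))  ≈⟨ *-congˡ (sym (*-assoc _ _ _)) ⟩
      a * (b * b⁻¹ * a⁻¹)    ≈⟨ *-congˡ (trans (*-congʳ bb⁻¹≈1) (*-identityˡ a⁻¹)) ⟩
      a * a⁻¹                ≈⟨ aa⁻¹≈1 ⟩
      1#                     ∎

  invertible-from-sides : ∀ {a l r} → l * a ≈ 1# → a * r ≈ 1# → Invertible 1# _*_ a
  invertible-from-sides {a} {l} {r} la≈1 ar≈1 = l , la≈1 , (begin
    a * l              ≈⟨ *-congˡ l≈r ⟩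
    a * r              ≈⟨ ar≈1 ⟩
    1#                 ∎)
    where
    l≈r : l ≈ r
    l≈r = begin
      l            ≈⟨ sym (*-identityʳ l) ⟩
      l * 1#       ≈⟨ *-congˡ (sym ar≈1) ⟩
      l * (a * r)  ≈⟨ sym (*-assoc _ _ _) ⟩
      l * a * r    ≈⟨ *-congʳ la≈1 ⟩
      1# * r       ≈⟨ *-identityˡ r ⟩
      r            ∎

  Invertible-resp : ∀ {a b} → a ≈ b → Invertible 1# _*_ a → Invertible 1# _*_ b
  Invertible-resp a≈b (a⁻¹ , a⁻¹a≈1 , aa⁻¹≈1) = a⁻¹ , trans (*-congˡ (sym a≈b)) a⁻¹a≈1 , trans (*-congʳ (sym a≈b)) aa⁻¹≈1

  inverse-unique : ∀ {a b a′ b′} → a ≈ b → a′ * a ≈ 1# → b * b′ ≈ 1# → a′ ≈ b′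
  inverse-unique {a} {b} {a′} {b′} a≈b a′a≈1 bb′≈1 = begin
    a′              ≈⟨ sym (*-identityʳ a′) ⟩
    a′ * 1#         ≈⟨ *-congˡ (sym bb′≈1) ⟩
    a′ * (b * b′)   ≈⟨ sym (*-assoc _ _ _) ⟩
    a′ * b * b′     ≈⟨ *-congʳ (trans (*-congˡ (sym a≈b)) a′a≈1) ⟩
    1# * b′         ≈⟨ *-identityˡ b′ ⟩
    b′              ∎

  -- Products of lists, so that a run of factors can be rewritten in place by prod-segment.
  prod : List Carrier → Carrier
  prod []       = 1#
  prod (a ∷ as) = a * prod as

  prod-++ : ∀ as bs → prod (as ++ bs) ≈ prod as * prod bs
  prod-++ []       bs = sym (*-identityˡ _)
  prod-++ (a ∷ as) bs = trans (*-congˡ (prod-++ as bs)) (sym (*-assoc _ _ _))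

  prod-segment : ∀ as bs bs′ cs → prod bs ≈ prod bs′ → prod (as ++ bs ++ cs) ≈ prod (as ++ bs′ ++ cs)
  prod-segment as bs bs′ cs bs≈bs′ = begin
    prod (as ++ bs ++ cs)      ≈⟨ prod-++ as (bs ++ cs) ⟩
    prod as * prod (bs ++ cs)  ≈⟨ *-congˡ (trans (prod-++ bs cs) (*-congʳ bs≈bs′)) ⟩
    prod as * (prod bs′ * prod cs)  ≈⟨ *-congˡ (sym (prod-++ bs′ cs)) ⟩
    prod as * prod (bs′ ++ cs) ≈⟨ sym (prod-++ as (bs′ ++ cs)) ⟩
    prod (as ++ bs′ ++ cs)     ∎

  prod₁ : ∀ a → prod [ a ] ≈ a
  prod₁ a = *-identityʳ a

  prod₂ : ∀ a b → prod (a ∷ b ∷ []) ≈ a * b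
  prod₂ a b = *-congˡ (*-identityʳ b)

  prod₃ : ∀ a b c → prod (a ∷ b ∷ c ∷ []) ≈ a * (b * c)
  prod₃ a b c = *-congˡ (prod₂ b c)

  prod-merge : ∀ as a b cs → prod (as ++ a ∷ b ∷ cs) ≈ prod (as ++ a * b ∷ cs)
  prod-merge as a b cs = prod-segment as (a ∷ b ∷ []) [ a * b ] cs (trans (prod₂ a b) (sym (prod₁ (a * b))))

  prod-replace : ∀ as {a a′} cs → a ≈ a′ → prod (as ++ a ∷ cs) ≈ prod (as ++ a′ ∷ cs)
  prod-replace as {a} {a′} cs a≈a′ = prod-segment as [ a ] [ a′ ] cs (trans (prod₁ a) (trans a≈a′ (sym (prod₁ a′))))

  prod-+ : ∀ as a b cs → prod (as ++ a + b ∷ cs) ≈ prod (as ++ a ∷ cs) + prod (as ++ b ∷ cs)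
  prod-+ as a b cs = begin
    prod (as ++ a + b ∷ cs)                   ≈⟨ prod-++ as _ ⟩
    prod as * ((a + b) * prod cs)             ≈⟨ *-congˡ (distribʳ _ _ _) ⟩
    prod as * (a * prod cs + b * prod cs)     ≈⟨ distribˡ _ _ _ ⟩
    prod as * (a * prod cs) + prod as * (b * prod cs)  ≈⟨ +-cong (sym (prod-++ as _)) (sym (prod-++ as _)) ⟩
    prod (as ++ a ∷ cs) + prod (as ++ b ∷ cs) ∎

  prod-central : ∀ {u} → Central u → ∀ as a cs → prod (as ++ u * a ∷ cs) ≈ u * prod (as ++ a ∷ cs)
  prod-central u-central []        a cs = *-assoc _ _ _
  prod-central u-central (a′ ∷ as) a cs = trans (*-congˡ (prod-central u-central as a cs)) (central-slide u-central _ _)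

  prod-cancel : ∀ as {a a′} cs → a * a′ ≈ 1# → prod (as ++ a ∷ a′ ∷ cs) ≈ prod (as ++ cs)
  prod-cancel as {a} {a′} cs aa′≈1 =
    prod-segment as (a ∷ a′ ∷ []) [] cs (trans (prod₂ a a′) aa′≈1)

  commutator : Carrier → Carrier → Carrier
  commutator a b = a * b - b * a

  1+p*1+q : ∀ p q → (1# + p) * (1# + q) ≈ 1# + p + q + p * q
  1+p*1+q p q = begin
    (1# + p) * (1# + q)                ≈⟨ distribˡ _ _ _ ⟩
    (1# + p) * 1# + (1# + p) * q       ≈⟨ +-cong (*-identityʳ _) (distribʳ _ _ _) ⟩
    1# + p + (1# * q + p * q)          ≈⟨ +-congˡ (+-congʳ (*-identityˡ q)) ⟩
    1# + p + (q + p * q)               ≈⟨ sym (+-assoc _ _ _) ⟩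
    1# + p + q + p * q                 ∎

  1+ub*1+va : ∀ {u v} → Central u → Central v → ∀ a b →
              (1# + u * b) * (1# + v * a) ≈ (1# + v * a) * (1# + u * b) + u * v * commutator b a
  1+ub*1+va {u} {v} u-central v-central a b = begin
      (1# + u * b) * (1# + v * a)
    ≈⟨ 1+p*1+q _ _ ⟩
      1# + u * b + v * a + u * b * (v * a)
    ≈⟨ +-cong (xy∙z≈xz∙y _ _ _) (central-collect v-central b a) ⟩
      1# + v * a + u * b + u * v * (b * a)
    ≈⟨ +-congˡ (*-congˡ (sym (x+[y-x]≈y (a * b) (b * a)))) ⟩
      1# + v * a + u * b + u * v * (a * b + commutator b a)
    ≈⟨ trans (+-congˡ (distribˡ _ _ _)) (sym (+-assoc _ _ _)) ⟩
      1# + v * a + u * b + u * v * (a * b) + u * v * commutator b a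
    ≈⟨ +-congʳ (+-congˡ (trans (*-congʳ (u-central v)) (sym (central-collect u-central a b)))) ⟩
      1# + v * a + u * b + v * a * (u * b) + u * v * commutator b a
    ≈⟨ +-congʳ (sym (1+p*1+q _ _)) ⟩
      (1# + v * a) * (1# + u * b) + u * v * commutator b a
    ∎
    where
    x+[y-x]≈y : ∀ x y → x + (y - x) ≈ y
    x+[y-x]≈y x y = trans (+-congˡ (+-comm _ _)) (trans (sym (+-assoc _ _ _)) (trans (+-congʳ (-‿inverseʳ x)) (+-identityˡ y)))

  1+ua*1+va : ∀ {u v} → Central u → Central v → ∀ a → (1# + u * a) * (1# + v * a) ≈ (1# + v * a) * (1# + u * a)
  1+ua*1+va {u} {v} u-central v-central a = begin
    (1# + u * a) * (1# + v * a)                               ≈⟨ 1+ub*1+va u-central v-central a a ⟩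
    (1# + v * a) * (1# + u * a) + u * v * commutator a a      ≈⟨ +-congˡ (trans (*-congˡ (-‿inverseʳ _)) (zeroʳ _)) ⟩
    (1# + v * a) * (1# + u * a) + 0#                          ≈⟨ +-identityʳ _ ⟩
    (1# + v * a) * (1# + u * a)                               ∎

  1+ua-intertwines : ∀ {u a b d} → Central u → a * d ≈ d * b → (1# + u * a) * d ≈ d * (1# + u * b)
  1+ua-intertwines {u} {a} {b} {d} u-central ad≈db = begin
    (1# + u * a) * d      ≈⟨ distribʳ _ _ _ ⟩
    1# * d + u * a * d    ≈⟨ +-cong (*-identityˡ d) (*-assoc _ _ _) ⟩
    d + u * (a * d)       ≈⟨ +-congˡ (*-congˡ ad≈db) ⟩
    d + u * (d * b)       ≈⟨ +-congˡ (sym (central-slide u-central d b)) ⟩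
    d + d * (u * b)       ≈⟨ sym (trans (distribˡ _ _ _) (+-congʳ (*-identityʳ d))) ⟩
    d * (1# + u * b)      ∎

  -- The induction step for E L s · E L t ≈ E L t · E L s, where L = x ∷ M ∷ʳ y, P = E M s, Q = E M t.
  module InductionStep {s t : Carrier} (s-central : Central s) (t-central : Central t) (x y : Carrier) where

    A B : Carrier → Carrier
    A v = 1# + v * x
    B v = 1# + v * y

    d : Carrier
    d = commutator y x

    swap-inside : ∀ {u v} → Central u → Central v → ∀ P Q → P * d ≈ d → d * Q ≈ d →
                  prod (P ∷ B u ∷ A v ∷ Q ∷ []) ≈ prod (P ∷ A v ∷ B u ∷ Q ∷ []) + u * v * d
    swap-inside {u} {v} u-central v-central P Q Pd≈d dQ≈d = begin
        prod (P ∷ B u ∷ A v ∷ Q ∷ [])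
      ≈⟨ prod-merge [ P ] (B u) (A v) [ Q ] ⟩
        prod (P ∷ B u * A v ∷ Q ∷ [])
      ≈⟨ prod-replace [ P ] [ Q ] (1+ub*1+va u-central v-central x y) ⟩
        prod (P ∷ A v * B u + u * v * d ∷ Q ∷ [])
      ≈⟨ prod-+ [ P ] _ _ [ Q ] ⟩
        prod (P ∷ A v * B u ∷ Q ∷ []) + prod (P ∷ u * v * d ∷ Q ∷ [])
      ≈⟨ +-cong (sym (prod-merge [ P ] (A v) (B u) [ Q ])) (prod-central (Central-* u-central v-central) [ P ] d [ Q ]) ⟩
        prod (P ∷ A v ∷ B u ∷ Q ∷ []) + u * v * prod (P ∷ d ∷ Q ∷ [])
      ≈⟨ +-congˡ (*-congˡ (trans (prod₃ P d Q) (trans (*-congˡ dQ≈d) Pd≈d))) ⟩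
        prod (P ∷ A v ∷ B u ∷ Q ∷ []) + u * v * d
      ∎

    swap-corner : x * d ≈ d * y → prod (A s ∷ s * t * d ∷ B t ∷ []) ≈ prod (A t ∷ t * s * d ∷ B s ∷ [])
    swap-corner xd≈dy = begin
        prod (A s ∷ s * t * d ∷ B t ∷ [])
      ≈⟨ prod-central st-central [ A s ] d [ B t ] ⟩
        s * t * prod (A s ∷ d ∷ B t ∷ [])
      ≈⟨ *-congˡ (trans (prod₃ _ _ _) (sym (*-assoc _ _ _))) ⟩
        s * t * (A s * d * B t)
      ≈⟨ *-cong (s-central t) (*-congʳ (1+ua-intertwines s-central xd≈dy)) ⟩
        t * s * (d * B s * B t)
      ≈⟨ *-congˡ (trans (*-assoc _ _ _) (trans (*-congˡ (1+ua*1+va s-central t-central y)) (sym (*-assoc _ _ _)))) ⟩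
        t * s * (d * B t * B s)
      ≈⟨ *-congˡ (*-congʳ (sym (1+ua-intertwines t-central xd≈dy))) ⟩
        t * s * (A t * d * B s)
      ≈⟨ *-congˡ (trans (*-assoc _ _ _) (sym (prod₃ _ _ _))) ⟩
        t * s * prod (A t ∷ d ∷ B s ∷ [])
      ≈⟨ sym (prod-central ts-central [ A t ] d [ B s ]) ⟩
        prod (A t ∷ t * s * d ∷ B s ∷ [])
      ∎
      where
      st-central = Central-* s-central t-central
      ts-central = Central-* t-central s-central

    swap-inside-prod : ∀ {u v} → Central u → Central v → ∀ L P Q R → P * d ≈ d → d * Q ≈ d →
                       prod (L ∷ P ∷ B u ∷ A v ∷ Q ∷ R ∷ [])
                         ≈ prod (L ∷ P ∷ A v ∷ B u ∷ Q ∷ R ∷ []) + prod (L ∷ u * v * d ∷ R ∷ [])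
    swap-inside-prod {u} {v} u-central v-central L P Q R Pd≈d dQ≈d = begin
        prod (L ∷ P ∷ B u ∷ A v ∷ Q ∷ R ∷ [])
      ≈⟨ prod-segment [ L ] (P ∷ B u ∷ A v ∷ Q ∷ []) [ prod (P ∷ A v ∷ B u ∷ Q ∷ []) + u * v * d ] [ R ]
           (trans (swap-inside u-central v-central P Q Pd≈d dQ≈d) (sym (prod₁ _))) ⟩
        prod (L ∷ prod (P ∷ A v ∷ B u ∷ Q ∷ []) + u * v * d ∷ R ∷ [])
      ≈⟨ prod-+ [ L ] _ _ [ R ] ⟩
        prod (L ∷ prod (P ∷ A v ∷ B u ∷ Q ∷ []) ∷ R ∷ []) + prod (L ∷ u * v * d ∷ R ∷ [])
      ≈⟨ +-congʳ (prod-segment [ L ] [ prod (P ∷ A v ∷ B u ∷ Q ∷ []) ] (P ∷ A v ∷ B u ∷ Q ∷ []) [ R ] (prod₁ _)) ⟩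
        prod (L ∷ P ∷ A v ∷ B u ∷ Q ∷ R ∷ []) + prod (L ∷ u * v * d ∷ R ∷ [])
      ∎

    module _ {P Q : Carrier} (P-invertible : Invertible 1# _*_ P) (Q-invertible : Invertible 1# _*_ Q)
             (PQ≈QP : P * Q ≈ Q * P) where

      private
        P⁻¹ = proj₁ P-invertible
        Q⁻¹ = proj₁ Q-invertible

      inverses-commute : Q⁻¹ * P⁻¹ ≈ P⁻¹ * Q⁻¹
      inverses-commute = inverse-unique PQ≈QP
        (proj₁ (proj₂ (Invertible-* P-invertible Q-invertible)))
        (proj₂ (proj₂ (Invertible-* Q-invertible P-invertible)))

      swap-middle : prod (A s ∷ P ∷ A t ∷ Q ∷ []) ≈ prod (A t ∷ Q ∷ A s ∷ P ∷ []) →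
                    prod (P ∷ B s ∷ Q ∷ B t ∷ []) ≈ prod (Q ∷ B t ∷ P ∷ B s ∷ []) →
                    prod (A s ∷ P ∷ A t ∷ B s ∷ Q ∷ B t ∷ []) ≈ prod (A t ∷ Q ∷ A s ∷ B t ∷ P ∷ B s ∷ [])
      swap-middle As-P-At-Q-comm P-Bs-Q-Bt-comm = begin
          prod (A s ∷ P ∷ A t ∷ B s ∷ Q ∷ B t ∷ [])
        ≈⟨ sym (prod-cancel (A s ∷ P ∷ A t ∷ []) (B s ∷ Q ∷ B t ∷ []) (proj₁ (proj₂ P-invertible))) ⟩
          prod (A s ∷ P ∷ A t ∷ P⁻¹ ∷ P ∷ B s ∷ Q ∷ B t ∷ [])
        ≈⟨ sym (prod-cancel (A s ∷ P ∷ A t ∷ []) (P⁻¹ ∷ P ∷ B s ∷ Q ∷ B t ∷ []) (proj₂ (proj₂ Q-invertible))) ⟩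
          prod (A s ∷ P ∷ A t ∷ Q ∷ Q⁻¹ ∷ P⁻¹ ∷ P ∷ B s ∷ Q ∷ B t ∷ [])
        ≈⟨ prod-segment [] (A s ∷ P ∷ A t ∷ Q ∷ []) (A t ∷ Q ∷ A s ∷ P ∷ [])
             (Q⁻¹ ∷ P⁻¹ ∷ P ∷ B s ∷ Q ∷ B t ∷ []) As-P-At-Q-comm ⟩
          prod (A t ∷ Q ∷ A s ∷ P ∷ Q⁻¹ ∷ P⁻¹ ∷ P ∷ B s ∷ Q ∷ B t ∷ [])
        ≈⟨ prod-segment (A t ∷ Q ∷ A s ∷ P ∷ []) (Q⁻¹ ∷ P⁻¹ ∷ []) (P⁻¹ ∷ Q⁻¹ ∷ []) (P ∷ B s ∷ Q ∷ B t ∷ [])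
             (trans (prod₂ _ _) (trans inverses-commute (sym (prod₂ _ _)))) ⟩
          prod (A t ∷ Q ∷ A s ∷ P ∷ P⁻¹ ∷ Q⁻¹ ∷ P ∷ B s ∷ Q ∷ B t ∷ [])
        ≈⟨ prod-segment (A t ∷ Q ∷ A s ∷ P ∷ P⁻¹ ∷ Q⁻¹ ∷ [])
             (P ∷ B s ∷ Q ∷ B t ∷ []) (Q ∷ B t ∷ P ∷ B s ∷ []) [] P-Bs-Q-Bt-comm ⟩
          prod (A t ∷ Q ∷ A s ∷ P ∷ P⁻¹ ∷ Q⁻¹ ∷ Q ∷ B t ∷ P ∷ B s ∷ [])
        ≈⟨ prod-cancel (A t ∷ Q ∷ A s ∷ []) (Q⁻¹ ∷ Q ∷ B t ∷ P ∷ B s ∷ []) (proj₂ (proj₂ P-invertible)) ⟩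
          prod (A t ∷ Q ∷ A s ∷ Q⁻¹ ∷ Q ∷ B t ∷ P ∷ B s ∷ [])
        ≈⟨ prod-cancel (A t ∷ Q ∷ A s ∷ []) (B t ∷ P ∷ B s ∷ []) (proj₁ (proj₂ Q-invertible)) ⟩
          prod (A t ∷ Q ∷ A s ∷ B t ∷ P ∷ B s ∷ [])
        ∎

      sandwich-commute : prod (A s ∷ P ∷ A t ∷ Q ∷ []) ≈ prod (A t ∷ Q ∷ A s ∷ P ∷ []) →
             prod (P ∷ B s ∷ Q ∷ B t ∷ []) ≈ prod (Q ∷ B t ∷ P ∷ B s ∷ []) →
             P * d ≈ d → d * P ≈ d → Q * d ≈ d → d * Q ≈ d → x * d ≈ d * y →
             prod (A s ∷ P ∷ B s ∷ A t ∷ Q ∷ B t ∷ []) ≈ prod (A t ∷ Q ∷ B t ∷ A s ∷ P ∷ B s ∷ [])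
      sandwich-commute As-P-At-Q-comm P-Bs-Q-Bt-comm Pd≈d dP≈d Qd≈d dQ≈d xd≈dy = begin
          prod (A s ∷ P ∷ B s ∷ A t ∷ Q ∷ B t ∷ [])
        ≈⟨ swap-inside-prod s-central t-central (A s) P Q (B t) Pd≈d dQ≈d ⟩
          prod (A s ∷ P ∷ A t ∷ B s ∷ Q ∷ B t ∷ []) + prod (A s ∷ s * t * d ∷ B t ∷ [])
        ≈⟨ +-cong (swap-middle As-P-At-Q-comm P-Bs-Q-Bt-comm) (swap-corner xd≈dy) ⟩
          prod (A t ∷ Q ∷ A s ∷ B t ∷ P ∷ B s ∷ []) + prod (A t ∷ t * s * d ∷ B s ∷ [])
        ≈⟨ sym (swap-inside-prod t-central s-central (A t) Q P (B s) Qd≈d dP≈d) ⟩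
          prod (A t ∷ Q ∷ B t ∷ A s ∷ P ∷ B s ∷ [])
        ∎

  Commute : Carrier → Carrier → Set _
  Commute a b = a * b ≈ b * a

  Commute-resp : ∀ {a a′ b b′} → a ≈ a′ → b ≈ b′ → Commute a b → Commute a′ b′
  Commute-resp a≈a′ b≈b′ ab≈ba = trans (*-cong (sym a≈a′) (sym b≈b′)) (trans ab≈ba (*-cong b≈b′ a≈a′))

  prod-swap : ∀ as bs → Commute (prod as) (prod bs) → prod (as ++ bs) ≈ prod (bs ++ as)
  prod-swap as bs comm = trans (prod-++ as bs) (trans comm (sym (prod-++ bs as)))

  module GeneratingFunction {a : Level} {Letter : Set a} (ℓ : Letter → Carrier) where

    E : List Letter → Carrier → Carrier
    E []      v = 1#
    E (b ∷ L) v = (1# + v * ℓ b) * E L v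

    E-∷ʳ : ∀ L b v → E (L ∷ʳ b) v ≈ E L v * (1# + v * ℓ b)
    E-∷ʳ []      b v = trans (*-identityʳ _) (sym (*-identityˡ _))
    E-∷ʳ (c ∷ L) b v = trans (*-congˡ (E-∷ʳ L b v)) (sym (*-assoc _ _ _))

    E-invertible : ∀ {v} → (∀ b → Invertible 1# _*_ (1# + v * ℓ b)) → ∀ L → Invertible 1# _*_ (E L v)
    E-invertible factor-invertible []      = Invertible-1#
    E-invertible factor-invertible (b ∷ L) = Invertible-* (factor-invertible b) (E-invertible factor-invertible L)

    E*d≈d : ∀ {v d} → Central v → ∀ L → All (λ b → ℓ b * d ≈ 0#) L → E L v * d ≈ d
    E*d≈d v-central []      []              = *-identityˡ _
    E*d≈d {v} {d} v-central (b ∷ L) (ℓbd≈0 ∷ ℓLd≈0) = begin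
      (1# + v * ℓ b) * E L v * d    ≈⟨ *-assoc _ _ _ ⟩
      (1# + v * ℓ b) * (E L v * d)  ≈⟨ *-congˡ (E*d≈d v-central L ℓLd≈0) ⟩
      (1# + v * ℓ b) * d            ≈⟨ distribʳ _ _ _ ⟩
      1# * d + v * ℓ b * d          ≈⟨ +-cong (*-identityˡ d) (trans (*-assoc _ _ _) (trans (*-congˡ ℓbd≈0) (zeroʳ v))) ⟩
      d + 0#                        ≈⟨ +-identityʳ d ⟩
      d                             ∎

    d*E≈d : ∀ {v d} → Central v → ∀ L → All (λ b → d * ℓ b ≈ 0#) L → d * E L v ≈ d
    d*E≈d v-central []      []              = *-identityʳ _
    d*E≈d {v} {d} v-central (b ∷ L) (dℓb≈0 ∷ dℓL≈0) = begin
      d * ((1# + v * ℓ b) * E L v)  ≈⟨ sym (*-assoc _ _ _) ⟩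
      d * (1# + v * ℓ b) * E L v    ≈⟨ *-congʳ d[1+vℓb]≈d ⟩
      d * E L v                     ≈⟨ d*E≈d v-central L dℓL≈0 ⟩
      d                             ∎
      where
      d[1+vℓb]≈d : d * (1# + v * ℓ b) ≈ d
      d[1+vℓb]≈d = begin
        d * (1# + v * ℓ b)        ≈⟨ distribˡ _ _ _ ⟩
        d * 1# + d * (v * ℓ b)    ≈⟨ +-cong (*-identityʳ d) (trans (central-slide v-central d (ℓ b)) (trans (*-congˡ dℓb≈0) (zeroʳ v))) ⟩
        d + 0#                    ≈⟨ +-identityʳ d ⟩
        d                         ∎

    AllPairs-∷ʳ⁻ : ∀ {r} {R : Letter → Letter → Set r} L y → AllPairs R (L ∷ʳ y) → AllPairs R L × All (λ b → R b y) L
    AllPairs-∷ʳ⁻ []      y _               = [] , []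
    AllPairs-∷ʳ⁻ (b ∷ L) y (Rb[L∷ʳy] ∷ L∷ʳy↓) with All.∷ʳ⁻ Rb[L∷ʳy] | AllPairs-∷ʳ⁻ L y L∷ʳy↓
    ... | RbL , Rby | L↓ , RLy = (RbL ∷ L↓) , (Rby ∷ RLy)

    length-∷ʳ : ∀ (L : List Letter) y → List.length (L ∷ʳ y) ≡.≡ suc (List.length L)
    length-∷ʳ L y = ≡.trans (length-++ L) (ℕ.+-comm (List.length L) 1)

    module _ {r : Level} (_<_ : Letter → Letter → Set r) {s t : Carrier} (s-central : Central s) (t-central : Central t)
             (1+sℓ-invertible : ∀ b → Invertible 1# _*_ (1# + s * ℓ b))
             (1+tℓ-invertible : ∀ b → Invertible 1# _*_ (1# + t * ℓ b))
             (ℓ-outer : ∀ {a c} → a < c → ℓ c * commutator (ℓ a) (ℓ c) ≈ commutator (ℓ a) (ℓ c) * ℓ a)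
             (ℓ-innerˡ : ∀ {a b c} → a < b → b < c → ℓ b * commutator (ℓ a) (ℓ c) ≈ 0#)
             (ℓ-innerʳ : ∀ {a b c} → a < b → b < c → commutator (ℓ a) (ℓ c) * ℓ b ≈ 0#) where

      _>_ : Letter → Letter → Set r
      a > b = b < a

      E-commute-step : ∀ x M y → All (_< x) (M ∷ʳ y) → AllPairs _>_ (M ∷ʳ y) →
                       Commute (E (x ∷ M) s) (E (x ∷ M) t) → Commute (E (M ∷ʳ y) s) (E (M ∷ʳ y) t) →
                       Commute (E M s) (E M t) → Commute (E (x ∷ M ∷ʳ y) s) (E (x ∷ M ∷ʳ y) t)
      E-commute-step x M y M∷ʳy<x M∷ʳy↓ xM-comm My-comm M-comm =
        Commute-resp (sym (E-as-prod s)) (sym (E-as-prod t)) (commute-from-prod (A s ∷ E M s ∷ B s ∷ []) (A t ∷ E M t ∷ B t ∷ [])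
          (sandwich-commute (E-invertible 1+sℓ-invertible M) (E-invertible 1+tℓ-invertible M) M-comm
            (prod-swap (A s ∷ E M s ∷ []) (A t ∷ E M t ∷ []) (Commute-resp (sym (prod₂ _ _)) (sym (prod₂ _ _)) xM-comm))
            (prod-swap (E M s ∷ B s ∷ []) (E M t ∷ B t ∷ [])
              (Commute-resp (trans (E-∷ʳ M y s) (sym (prod₂ _ _))) (trans (E-∷ʳ M y t) (sym (prod₂ _ _))) My-comm))
            (E*d≈d s-central M ℓM*d≈0) (d*E≈d s-central M d*ℓM≈0)
            (E*d≈d t-central M ℓM*d≈0) (d*E≈d t-central M d*ℓM≈0)
            (ℓ-outer y<x)))
        where
        open InductionStep s-central t-central (ℓ x) (ℓ y)
        y<x = proj₂ (All.∷ʳ⁻ M∷ʳy<x)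
        y<M<x : All (λ b → y < b × b < x) M
        y<M<x = All.zip (proj₂ (AllPairs-∷ʳ⁻ M y M∷ʳy↓) , proj₁ (All.∷ʳ⁻ M∷ʳy<x))
        ℓM*d≈0 : All (λ b → ℓ b * d ≈ 0#) M
        ℓM*d≈0 = All.map (λ (y<b , b<x) → ℓ-innerˡ y<b b<x) y<M<x
        d*ℓM≈0 : All (λ b → d * ℓ b ≈ 0#) M
        d*ℓM≈0 = All.map (λ (y<b , b<x) → ℓ-innerʳ y<b b<x) y<M<x
        E-as-prod : ∀ v → E (x ∷ M ∷ʳ y) v ≈ prod (A v ∷ E M v ∷ B v ∷ [])
        E-as-prod v = trans (*-congˡ (E-∷ʳ M y v)) (sym (prod₃ _ _ _))
        commute-from-prod : ∀ as bs → prod (as ++ bs) ≈ prod (bs ++ as) → Commute (prod as) (prod bs)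
        commute-from-prod as bs eq = trans (sym (prod-++ as bs)) (trans eq (prod-++ bs as))

      E-commute : ∀ L → AllPairs _>_ L → Commute (E L s) (E L t)
      E-commute L = bounded (List.length L) L ℕ.≤-refl
        where
        bounded : ∀ n L → List.length L ℕ.≤ n → AllPairs _>_ L → Commute (E L s) (E L t)
        bounded n       []      _          _          = refl
        bounded (suc n) (x ∷ M) (s≤s |M|≤n) (M<x ∷ M↓) with List.initLast M
        ... | [] = Commute-resp (sym (*-identityʳ _)) (sym (*-identityʳ _)) (1+ua*1+va s-central t-central (ℓ x))
        ... | M′ ∷ʳ′ y = E-commute-step x M′ y M<x M↓
          (bounded n (x ∷ M′) |xM′|≤n (proj₁ (All.∷ʳ⁻ M<x) ∷ proj₁ (AllPairs-∷ʳ⁻ M′ y M↓)))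
          (bounded n (M′ ∷ʳ y) |M|≤n M↓)
          (bounded n M′ (ℕ.≤-trans (ℕ.n≤1+n _) |xM′|≤n) (proj₁ (AllPairs-∷ʳ⁻ M′ y M↓)))
          where
          |xM′|≤n : suc (List.length M′) ℕ.≤ n
          |xM′|≤n = ≡.subst (ℕ._≤ n) (length-∷ʳ M′ y) |M|≤n

module _ {N : ℕ} where

  open RingElements (quotientRing N) using (commutator)

  u : Fin N → Poly N
  u a = mono (a ∷ [])

  -- The generators of I_B in terms of commutators: up to the order of the terms and an overall
  -- sign, the formal sums on the two sides are the generators themselves.
  u-outer : ∀ {a c} → a <F c → u c ⊗ commutator (u a) (u c) ≈ᴮ commutator (u a) (u c) ⊗ u a
  u-outer {a} {c} a<c = mk≈ᴮ (inResp reorder (inScale -[1+ 0 ] (inGen (genB1 a c a<c))))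
    where
    t₁ t₂ t₃ t₄ : ℤ × Word N
    t₁ = 1ℤ , c ∷ a ∷ c ∷ []
    t₂ = -[1+ 0 ] , c ∷ c ∷ a ∷ []
    t₃ = -[1+ 0 ] , a ∷ c ∷ a ∷ []
    t₄ = 1ℤ , c ∷ a ∷ a ∷ []
    reorder : (t₂ ∷ t₃ ∷ t₁ ∷ t₄ ∷ []) ≐ (t₁ ∷ t₂ ∷ t₃ ∷ t₄ ∷ [])
    reorder w = ≡.trans (coeff-∷-cong t₂ (coeff-swap t₃ t₁ (t₄ ∷ [])) w) (coeff-swap t₂ t₁ (t₃ ∷ t₄ ∷ []) w)

  u-innerˡ : ∀ {a b c} → a <F b → b <F c → u b ⊗ commutator (u a) (u c) ≈ᴮ []
  u-innerˡ {a} {b} {c} a<b b<c =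
    mk≈ᴮ (inResp (coeff-swap (-[1+ 0 ] , b ∷ c ∷ a ∷ []) (1ℤ , b ∷ a ∷ c ∷ []) []) (inScale -[1+ 0 ] (inGen (genB2 a b c a<b b<c))))

  u-innerʳ : ∀ {a b c} → a <F b → b <F c → commutator (u a) (u c) ⊗ u b ≈ᴮ []
  u-innerʳ {a} {b} {c} a<b b<c = mk≈ᴮ (inGen (genB3 a b c a<b b<c))

module HomomorphismProperties {c₁ ℓ₁ c₂ ℓ₂ : Level} (R : Ring c₁ ℓ₁) (S : Ring c₂ ℓ₂)
         (h : RingHomomorphism (Ring.rawRing R) (Ring.rawRing S)) where

  private
    module R = Ring R
    module S = Ring S
    module RE = RingElements R
    module SE = RingElements S
  open RingHomomorphism h
  open import Algebra.Definitions using (Invertible)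

  ⟦⟧-commutator : ∀ a b → ⟦ RE.commutator a b ⟧ S.≈ SE.commutator ⟦ a ⟧ ⟦ b ⟧
  ⟦⟧-commutator a b = S.trans (+-homo _ _) (S.+-cong (*-homo a b) (S.trans (-‿homo _) (S.-‿cong (*-homo b a))))

  ⟦⟧-*-commutator : ∀ x a b → ⟦ x R.* RE.commutator a b ⟧ S.≈ ⟦ x ⟧ S.* SE.commutator ⟦ a ⟧ ⟦ b ⟧
  ⟦⟧-*-commutator x a b = S.trans (*-homo _ _) (S.*-congˡ (⟦⟧-commutator a b))

  ⟦⟧-commutator-* : ∀ x a b → ⟦ RE.commutator a b R.* x ⟧ S.≈ SE.commutator ⟦ a ⟧ ⟦ b ⟧ S.* ⟦ x ⟧
  ⟦⟧-commutator-* x a b = S.trans (*-homo _ _) (S.*-congʳ (⟦⟧-commutator a b))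

  ⟦⟧-E : ∀ {a} {Letter : Set a} (ℓ : Letter → R.Carrier) L v →
         ⟦ RE.GeneratingFunction.E ℓ L v ⟧ S.≈ SE.GeneratingFunction.E (λ b → ⟦ ℓ b ⟧) L ⟦ v ⟧
  ⟦⟧-E ℓ []      v = 1#-homo
  ⟦⟧-E ℓ (b ∷ L) v = S.trans (*-homo _ _) (S.*-cong (S.trans (+-homo _ _) (S.+-cong 1#-homo (*-homo v (ℓ b)))) (⟦⟧-E ℓ L v))

  ⟦⟧-invertible : ∀ {a} → Invertible R._≈_ R.1# R._*_ a → Invertible S._≈_ S.1# S._*_ ⟦ a ⟧
  ⟦⟧-invertible (a⁻¹ , a⁻¹a≈1 , aa⁻¹≈1) =
    ⟦ a⁻¹ ⟧ , S.trans (S.sym (*-homo _ _)) (S.trans (⟦⟧-cong a⁻¹a≈1) 1#-homo)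
            , S.trans (S.sym (*-homo _ _)) (S.trans (⟦⟧-cong aa⁻¹≈1) 1#-homo)

module _ {N : ℕ} {c ℓ : Level} (K : Ring c ℓ) (ι : RingHomomorphism (Ring.rawRing (quotientRing N)) (Ring.rawRing K)) where

  open Ring K
  open RingHomomorphism ι
  open PowerSeries K
  open RingElements powerSeriesRing using (module GeneratingFunction)
  open GeneratingFunction (λ b → const ⟦ u b ⟧)
  open SetoidReasoning setoid

  E-coefficients : ∀ L → E L X ≋ (λ n → ⟦ eList n L ⟧)
  E-coefficients []      zero    = sym 1#-homo
  E-coefficients []      (suc n) = sym 0#-homo
  E-coefficients (b ∷ L) n = begin
      ((𝟙 ⊞ X ⊠ const ⟦ u b ⟧) ⊠ E L X) n
    ≈⟨ ⊠-cong (λ _ → refl) (E-coefficients L) n ⟩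
      ((𝟙 ⊞ X ⊠ const ⟦ u b ⟧) ⊠ (λ k → ⟦ eList k L ⟧)) n
    ≈⟨ 1+Xa⊠ ⟦ u b ⟧ _ n ⟩
      ⟦ eList n L ⟧ + shift (λ k → ⟦ u b ⟧ * ⟦ eList k L ⟧) n
    ≈⟨ recurrence n ⟩
      ⟦ eList n (b ∷ L) ⟧
    ∎
    where
    recurrence : ∀ n → ⟦ eList n L ⟧ + shift (λ k → ⟦ u b ⟧ * ⟦ eList k L ⟧) n ≈ ⟦ eList n (b ∷ L) ⟧
    recurrence zero    = +-identityʳ _
    recurrence (suc k) = sym (trans (+-homo _ _) (trans (+-congʳ (*-homo _ _)) (+-comm _ _)))

lettersBelow-decreasing : ∀ {N} m → AllPairs (flip _<F_) (lettersBelow {N} m)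
lettersBelow-decreasing {N} m = AllPairs.filter⁺ _ (reverse⁺ (AllPairs.tabulate⁺-< (λ i<j → i<j)))
  where
  All-reverse⁺ : ∀ {P : Fin N → Set} {xs} → All P xs → All P (reverse xs)
  All-reverse⁺ {xs = []}     []         = []
  All-reverse⁺ {xs = x ∷ xs} (px ∷ pxs) =
    ≡.subst (All _) (≡.sym (List.unfold-reverse x xs)) (All.∷ʳ⁺ (All-reverse⁺ pxs) px)
  reverse⁺ : ∀ {xs : List (Fin N)} → AllPairs _<F_ xs → AllPairs (flip _<F_) (reverse xs)
  reverse⁺ {[]}     []           = []
  reverse⁺ {x ∷ xs} (x<xs ∷ xs↑) = ≡.subst (AllPairs (flip _<F_)) (≡.sym (List.unfold-reverse x xs))
    (AllPairs.++⁺ (reverse⁺ xs↑) ([] ∷ []) (All.map (_∷ []) (All-reverse⁺ x<xs)))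

-- Inside (U/I_B)[[t]][[s]] the variables s and t are central and the coefficient of sⁱ tʲ
-- in E L s · E L t is e_i e_j, so the commutation of the e_k follows from that of E L s and E L t.
module _ (N : ℕ) where

  private
    R = quotientRing N
    module S₁ = PowerSeries R
    module S₂ = PowerSeries S₁.powerSeriesRing
    module R  = Ring R
    module R₁ = Ring S₁.powerSeriesRing
    module R₂ = Ring S₂.powerSeriesRing
    ι₁ = S₁.constHomomorphism
    ι₂ = S₂.constHomomorphism
    ι  = Composition.ringHomomorphism {M₁ = R} {M₂ = S₁.powerSeriesRing} {M₃ = S₂.powerSeriesRing} ι₁ ι₂
    module ι = RingHomomorphism ι
    open HomomorphismProperties R S₂.powerSeriesRing ι

  open R₂ using (_+_; _*_; 0#; 1#)
  open import Algebra.Definitions R₂._≈_ using (Invertible)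
  open RingElements S₂.powerSeriesRing

  private
    ℓ : Fin N → R₂.Carrier
    ℓ a = ι.⟦ u a ⟧

    s t : R₂.Carrier
    s = S₂.X
    t = S₂.const S₁.X

  open GeneratingFunction ℓ

  private
    ℓ-outer : ∀ {a c} → a <F c → ℓ c * commutator (ℓ a) (ℓ c) R₂.≈ commutator (ℓ a) (ℓ c) * ℓ a
    ℓ-outer {a} {c} a<c = R₂.trans (R₂.sym (⟦⟧-*-commutator (u c) (u a) (u c)))
                            (R₂.trans (ι.⟦⟧-cong (u-outer a<c)) (⟦⟧-commutator-* (u a) (u a) (u c)))

    ℓ-innerˡ : ∀ {a b c} → a <F b → b <F c → ℓ b * commutator (ℓ a) (ℓ c) R₂.≈ 0#
    ℓ-innerˡ {a} {b} {c} a<b b<c = R₂.trans (R₂.sym (⟦⟧-*-commutator (u b) (u a) (u c)))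
                                     (R₂.trans (ι.⟦⟧-cong (u-innerˡ a<b b<c)) ι.0#-homo)

    ℓ-innerʳ : ∀ {a b c} → a <F b → b <F c → commutator (ℓ a) (ℓ c) * ℓ b R₂.≈ 0#
    ℓ-innerʳ {a} {b} {c} a<b b<c = R₂.trans (R₂.sym (⟦⟧-commutator-* (u b) (u a) (u c)))
                                     (R₂.trans (ι.⟦⟧-cong (u-innerʳ a<b b<c)) ι.0#-homo)

    1+sℓ-invertible : ∀ a → Invertible 1# _*_ (1# + s * ℓ a)
    1+sℓ-invertible a = invertible-from-sides (S₂.1+Xa-inverseˡ _) (S₂.1+Xa-inverseʳ _)

    1+tℓ-invertible : ∀ a → Invertible 1# _*_ (1# + t * ℓ a)
    1+tℓ-invertible a = Invertible-resp
      (R₂.trans (RingHomomorphism.+-homo ι₂ _ _) (R₂.+-cong (RingHomomorphism.1#-homo ι₂) (RingHomomorphism.*-homo ι₂ _ _)))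
      (HomomorphismProperties.⟦⟧-invertible S₁.powerSeriesRing S₂.powerSeriesRing ι₂
        (RingElements.invertible-from-sides S₁.powerSeriesRing (S₁.1+Xa-inverseˡ (u a)) (S₁.1+Xa-inverseʳ (u a))))

    E-s-coefficients : ∀ L → E L s R₂.≈ (λ n → S₁.const (eList n L))
    E-s-coefficients = E-coefficients S₁.powerSeriesRing ι₁

    E-t-coefficients : ∀ L → E L t R₂.≈ S₂.const (λ n → eList n L)
    E-t-coefficients L = R₂.trans
      (R₂.sym (HomomorphismProperties.⟦⟧-E S₁.powerSeriesRing S₂.powerSeriesRing ι₂ (λ a → S₁.const (u a)) L S₁.X))
      (RingHomomorphism.⟦⟧-cong ι₂ (E-coefficients R (Identity.ringHomomorphism R) L))

  eList-commute : ∀ (L : List (Fin N)) → AllPairs (flip _<F_) L → ∀ i j → eList i L ⊗ eList j L ≈ᴮ eList j L ⊗ eList i L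
  eList-commute L L↓ i j = R.trans (R.sym st-coefficient) (R.trans (E-st-comm i j) ts-coefficient)
    where
    open SetoidReasoning R.setoid
    F : R₂.Carrier
    F n = S₁.const (eList n L)
    G : R₁.Carrier
    G n = eList n L

    E-st-comm : E L s * E L t R₂.≈ E L t * E L s
    E-st-comm = E-commute _<F_ S₂.X-central (S₂.const-central S₁.X S₁.X-central)
      1+sℓ-invertible 1+tℓ-invertible ℓ-outer ℓ-innerˡ ℓ-innerʳ L L↓

    st-coefficient : (E L s * E L t) i j R.≈ eList i L ⊗ eList j L
    st-coefficient = begin
      (E L s * E L t) i j          ≈⟨ R₂.*-cong (E-s-coefficients L) (E-t-coefficients L) i j ⟩
      (F * S₂.const G) i j         ≈⟨ S₂.⊠-constʳ F G i j ⟩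
      (F i S₁.⊠ G) j               ≈⟨ S₁.⊠-constˡ (eList i L) G j ⟩
      eList i L ⊗ eList j L        ∎

    ts-coefficient : (E L t * E L s) i j R.≈ eList j L ⊗ eList i L
    ts-coefficient = begin
      (E L t * E L s) i j          ≈⟨ R₂.*-cong (E-t-coefficients L) (E-s-coefficients L) i j ⟩
      (S₂.const G * F) i j         ≈⟨ S₂.⊠-constˡ G F i j ⟩
      (G S₁.⊠ F i) j               ≈⟨ S₁.⊠-constʳ G (eList i L) j ⟩
      eList j L ⊗ eList i L        ∎

e-commute : ∀ {N} (a b : ℤ) m → e {N} a m ⊗ e b m ≈ᴮ e b m ⊗ e a m
e-commute {N} (+ a)    (+ b)    m = eList-commute N (lettersBelow m) (lettersBelow-decreasing m) a b
e-commute     (+ a)    -[1+ b ] m = ≡⇒≈ᴮ (⊗-zeroʳ (e (+ a) m))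
e-commute     -[1+ a ] (+ b)    m = ≡⇒≈ᴮ (≡.sym (⊗-zeroʳ (e (+ b) m)))
e-commute     -[1+ a ] -[1+ b ] m = ≡⇒≈ᴮ ≡.refl

swapAt : {l : ℕ} → Fin l → Fin (suc l) → Fin (suc l)
swapAt Fin.zero    Fin.zero                = Fin.suc Fin.zero
swapAt Fin.zero    (Fin.suc Fin.zero)      = Fin.zero
swapAt Fin.zero    (Fin.suc (Fin.suc i))   = Fin.suc (Fin.suc i)
swapAt (Fin.suc k) Fin.zero                = Fin.zero
swapAt (Fin.suc k) (Fin.suc i)             = Fin.suc (swapAt k i)

swapAt-inject₁ : {l : ℕ} (k : Fin l) → swapAt k (inject₁ k) ≡ Fin.suc k
swapAt-inject₁ Fin.zero    = ≡.refl
swapAt-inject₁ (Fin.suc k) = ≡.cong Fin.suc (swapAt-inject₁ k)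

swapAt-suc : {l : ℕ} (k : Fin l) → swapAt k (Fin.suc k) ≡ inject₁ k
swapAt-suc Fin.zero    = ≡.refl
swapAt-suc (Fin.suc k) = ≡.cong Fin.suc (swapAt-suc k)

swapAt-invariant : ∀ {a} {A : Set a} {l} (g : Fin (suc l) → A) (k : Fin l) →
                   g (inject₁ k) ≡ g (Fin.suc k) → ∀ i → g (swapAt k i) ≡ g i
swapAt-invariant g Fin.zero    gk≡gk+1 Fin.zero              = ≡.sym gk≡gk+1
swapAt-invariant g Fin.zero    gk≡gk+1 (Fin.suc Fin.zero)    = gk≡gk+1
swapAt-invariant g Fin.zero    gk≡gk+1 (Fin.suc (Fin.suc i)) = ≡.refl
swapAt-invariant g (Fin.suc k) gk≡gk+1 Fin.zero              = ≡.refl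
swapAt-invariant g (Fin.suc k) gk≡gk+1 (Fin.suc i)           = swapAt-invariant (λ i → g (Fin.suc i)) k gk≡gk+1 i

module BigOperators {c ℓ : Level} (M : CommutativeMonoid c ℓ) where

  open CommutativeMonoid M
  open SetoidReasoning setoid
  open import Algebra.Properties.Monoid.Sum monoid public using (sum; sum-cong-≋)
  open import Algebra.Properties.CommutativeSemigroup commutativeSemigroup using (interchange; x∙yz≈y∙xz)

  Σ : List Carrier → Carrier
  Σ = foldr _∙_ ε

  Σ-cong : ∀ {a} {A : Set a} {f g : A → Carrier} (L : List A) → (∀ x → f x ≈ g x) → Σ (map f L) ≈ Σ (map g L)
  Σ-cong []      f≈g = refl
  Σ-cong (x ∷ L) f≈g = ∙-cong (f≈g x) (Σ-cong L f≈g)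

  Σ-++ : ∀ xs ys → Σ (xs ++ ys) ≈ Σ xs ∙ Σ ys
  Σ-++ []       ys = sym (identityˡ _)
  Σ-++ (x ∷ xs) ys = trans (∙-congˡ (Σ-++ xs ys)) (sym (assoc _ _ _))

  Σ-∙ : ∀ {a} {A : Set a} (f g : A → Carrier) L → Σ (map (λ x → f x ∙ g x) L) ≈ Σ (map f L) ∙ Σ (map g L)
  Σ-∙ f g []      = sym (identityˡ _)
  Σ-∙ f g (x ∷ L) = trans (∙-congˡ (Σ-∙ f g L)) (interchange _ _ _ _)

  Σ-ε : ∀ {a} {A : Set a} (L : List A) → Σ (map (λ _ → ε) L) ≈ ε
  Σ-ε []      = refl
  Σ-ε (x ∷ L) = trans (identityˡ _) (Σ-ε L)

  Σ-concatMap : ∀ {a b} {A : Set a} {B : Set b} (f : B → Carrier) (h : A → List B) L →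
                Σ (map f (concatMap h L)) ≈ Σ (map (λ x → Σ (map f (h x))) L)
  Σ-concatMap f h []      = refl
  Σ-concatMap f h (x ∷ L) = begin
    Σ (map f (h x ++ concatMap h L))                ≡⟨ ≡.cong Σ (map-++ f (h x) _) ⟩
    Σ (map f (h x) ++ map f (concatMap h L))        ≈⟨ Σ-++ (map f (h x)) _ ⟩
    Σ (map f (h x)) ∙ Σ (map f (concatMap h L))     ≈⟨ ∙-congˡ (Σ-concatMap f h L) ⟩
    Σ (map f (h x)) ∙ Σ (map (λ x → Σ (map f (h x))) L) ∎

  Σ-filter : ∀ {a p} {A : Set a} {P : Pred A p} (P? : Decidable P) (f : A → Carrier) L →
             Σ (map f (filter P? L)) ≈ Σ (map (λ x → if does (P? x) then f x else ε) L)
  Σ-filter P? f []      = refl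
  Σ-filter P? f (x ∷ L) with does (P? x)
  ... | true  = ∙-congˡ (Σ-filter P? f L)
  ... | false = trans (Σ-filter P? f L) (sym (identityˡ _))

  Σ-allFin : ∀ {n} (φ : Fin n → Carrier) → Σ (map φ (allFin n)) ≈ sum φ
  Σ-allFin {zero}  φ = refl
  Σ-allFin {suc n} φ = ∙-congˡ (trans (reflexive (≡.cong Σ reindex)) (Σ-allFin (λ i → φ (Fin.suc i))))
    where
    reindex : map φ (tabulate {n = n} Fin.suc) ≡ map (λ i → φ (Fin.suc i)) (allFin n)
    reindex = ≡.trans (map-tabulate Fin.suc φ) (≡.sym (map-tabulate (λ i → i) (λ i → φ (Fin.suc i))))

  Σ-comm : ∀ {a b} {A : Set a} {B : Set b} (H : A → B → Carrier) (LA : List A) (LB : List B) →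
           Σ (map (λ x → Σ (map (H x) LB)) LA) ≈ Σ (map (λ y → Σ (map (λ x → H x y) LA)) LB)
  Σ-comm H []       LB = sym (Σ-ε LB)
  Σ-comm H (x ∷ LA) LB = trans (∙-congˡ (Σ-comm H LA LB)) (sym (Σ-∙ (H x) _ LB))

  sum-swapAt : {l : ℕ} (k : Fin l) (φ : Fin (suc l) → Carrier) → sum (λ i → φ (swapAt k i)) ≈ sum φ
  sum-swapAt Fin.zero    φ = x∙yz≈y∙xz _ _ _
  sum-swapAt (Fin.suc k) φ = ∙-congˡ (sum-swapAt k (λ i → φ (Fin.suc i)))

  pairProduct : (n : ℕ) → (Fin n → Fin n → Carrier) → Carrier
  pairProduct zero    c = ε
  pairProduct (suc n) c = sum (λ j → c Fin.zero (Fin.suc j)) ∙ pairProduct n (λ i j → c (Fin.suc i) (Fin.suc j))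

  pairProduct-cong : (n : ℕ) {c c′ : Fin n → Fin n → Carrier} → (∀ i j → c i j ≈ c′ i j) → pairProduct n c ≈ pairProduct n c′
  pairProduct-cong zero    c≈c′ = refl
  pairProduct-cong (suc n) c≈c′ =
    ∙-cong (sum-cong-≋ (λ j → c≈c′ Fin.zero (Fin.suc j))) (pairProduct-cong n (λ i j → c≈c′ (Fin.suc i) (Fin.suc j)))

  Σ-pairs : (n : ℕ) (φ : Fin n × Fin n → Carrier) → Σ (map φ (pairs n)) ≈ pairProduct n (λ i j → φ (i , j))
  Σ-pairs n φ = begin
      Σ (map φ (pairs n))
    ≈⟨ Σ-concatMap φ _ (allFin n) ⟩
      Σ (map (λ i → Σ (map φ (map (i ,_) (filter (i <?_) (allFin n))))) (allFin n))
    ≈⟨ Σ-cong (allFin n) (λ i → trans (reflexive (≡.cong Σ (≡.sym (map-∘ (filter (i <?_) (allFin n))))))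
                                        (trans (Σ-filter (i <?_) (λ j → φ (i , j)) (allFin n)) (Σ-allFin (row-entry i)))) ⟩
      Σ (map row (allFin n))
    ≈⟨ Σ-allFin row ⟩
      sum row
    ≈⟨ rows≈pairProduct n (λ i j → φ (i , j)) ⟩
      pairProduct n (λ i j → φ (i , j))
    ∎
    where
    _<?_ : (i j : Fin n) → Relation.Nullary.Dec (toℕ i ℕ.< toℕ j)
    i <? j = toℕ i ℕ.<? toℕ j
    row-entry : Fin n → Fin n → Carrier
    row-entry i j = if does (i <? j) then φ (i , j) else ε
    row : Fin n → Carrier
    row i = sum (row-entry i)
    rows≈pairProduct : ∀ n (c : Fin n → Fin n → Carrier) →
                       sum (λ i → sum (λ j → if does (toℕ i ℕ.<? toℕ j) then c i j else ε)) ≈ pairProduct n c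
    rows≈pairProduct zero    c = refl
    rows≈pairProduct (suc n) c = ∙-cong (identityˡ _)
      (trans (sum-cong-≋ {n} (λ i → identityˡ (sum (λ j → if does (toℕ i ℕ.<? toℕ j) then c′ i j else ε))))
             (rows≈pairProduct n c′))
      where
      c′ : Fin n → Fin n → Carrier
      c′ i j = c (Fin.suc i) (Fin.suc j)

  pairProduct-swapAt : {l : ℕ} (k : Fin l) (c : Fin (suc l) → Fin (suc l) → Carrier) →
                       pairProduct (suc l) (λ i j → c (swapAt k i) (swapAt k j)) ∙ c (inject₁ k) (Fin.suc k)
                         ≈ pairProduct (suc l) c ∙ c (Fin.suc k) (inject₁ k)
  pairProduct-swapAt {suc l} Fin.zero c = begin
      ((c 1′ 0′ ∙ row₁) ∙ (row₀ ∙ rest)) ∙ c 0′ 1′   ≈⟨ comm _ _ ⟩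
      c 0′ 1′ ∙ ((c 1′ 0′ ∙ row₁) ∙ (row₀ ∙ rest))   ≈⟨ ∙-congˡ (interchange _ _ _ _) ⟩
      c 0′ 1′ ∙ ((c 1′ 0′ ∙ row₀) ∙ (row₁ ∙ rest))   ≈⟨ sym (assoc _ _ _) ⟩
      (c 0′ 1′ ∙ (c 1′ 0′ ∙ row₀)) ∙ (row₁ ∙ rest)   ≈⟨ ∙-congʳ (x∙yz≈y∙xz _ _ _) ⟩
      (c 1′ 0′ ∙ (c 0′ 1′ ∙ row₀)) ∙ (row₁ ∙ rest)   ≈⟨ assoc _ _ _ ⟩
      c 1′ 0′ ∙ ((c 0′ 1′ ∙ row₀) ∙ (row₁ ∙ rest))   ≈⟨ comm _ _ ⟩
      ((c 0′ 1′ ∙ row₀) ∙ (row₁ ∙ rest)) ∙ c 1′ 0′   ∎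
    where
    0′ 1′ : Fin (suc (suc l))
    0′ = Fin.zero
    1′ = Fin.suc Fin.zero
    row₀ = sum (λ j → c 0′ (Fin.suc (Fin.suc j)))
    row₁ = sum (λ j → c 1′ (Fin.suc (Fin.suc j)))
    rest = pairProduct l (λ i j → c (Fin.suc (Fin.suc i)) (Fin.suc (Fin.suc j)))
  pairProduct-swapAt {suc l} (Fin.suc k) c = begin
      (row₀′ ∙ pairProduct (suc l) (λ i j → c′ (swapAt k i) (swapAt k j))) ∙ c′ (inject₁ k) (Fin.suc k)
    ≈⟨ assoc _ _ _ ⟩
      row₀′ ∙ (pairProduct (suc l) (λ i j → c′ (swapAt k i) (swapAt k j)) ∙ c′ (inject₁ k) (Fin.suc k))
    ≈⟨ ∙-cong (sum-swapAt k (λ j → c Fin.zero (Fin.suc j))) (pairProduct-swapAt k c′) ⟩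
      row₀ ∙ (pairProduct (suc l) c′ ∙ c′ (Fin.suc k) (inject₁ k))
    ≈⟨ sym (assoc _ _ _) ⟩
      (row₀ ∙ pairProduct (suc l) c′) ∙ c′ (Fin.suc k) (inject₁ k)
    ∎
    where
    c′ : Fin (suc l) → Fin (suc l) → Carrier
    c′ i j = c (Fin.suc i) (Fin.suc j)
    row₀′ = sum (λ j → c Fin.zero (Fin.suc (swapAt k j)))
    row₀ = sum (λ j → c Fin.zero (Fin.suc j))

  module _ {m : ℕ} where

    open import Data.Vec.Functional as Vector using () renaming (_∷_ to _◂_)

    RespectsPointwise : ∀ {n} → ((Fin n → Fin m) → Carrier) → Set _
    RespectsPointwise {n} G = ∀ {π π′ : Fin n → Fin m} → (∀ i → π i ≡ π′ i) → G π ≈ G π′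

    ◂-cong : ∀ {n} (x : Fin m) {f f′ : Fin n → Fin m} → (∀ i → f i ≡ f′ i) → ∀ i → (x ◂ f) i ≡ (x ◂ f′) i
    ◂-cong x f≗f′ Fin.zero    = ≡.refl
    ◂-cong x f≗f′ (Fin.suc i) = f≗f′ i

    Σ-allMaps-suc : ∀ {n} (G : (Fin (suc n) → Fin m) → Carrier) → RespectsPointwise G →
                    Σ (map G (allMaps (suc n) m)) ≈ Σ (map (λ f → Σ (map (λ x → G (x ◂ f)) (allFin m))) (allMaps n m))
    Σ-allMaps-suc {n} G G-resp = trans (Σ-concatMap G _ (allMaps n m)) (Σ-cong (allMaps n m) (λ f →
      trans (reflexive (≡.cong Σ (≡.sym (map-∘ (allFin m))))) (Σ-cong (allFin m) (λ x →
        G-resp (λ { Fin.zero → ≡.refl ; (Fin.suc i) → ≡.refl })))))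

    Σ-allMaps-swapAt : ∀ {l} (k : Fin l) (G : (Fin (suc l) → Fin m) → Carrier) → RespectsPointwise G →
                       Σ (map G (allMaps (suc l) m)) ≈ Σ (map (λ π → G (λ i → π (swapAt k i))) (allMaps (suc l) m))
    Σ-allMaps-swapAt {suc l} Fin.zero G G-resp = begin
        Σ (map G (allMaps (suc (suc l)) m))
      ≈⟨ unfold₂ G G-resp ⟩
        Σ (map (λ g → Σ (map (λ y → Σ (map (λ x → G (x ◂ (y ◂ g))) (allFin m))) (allFin m))) (allMaps l m))
      ≈⟨ Σ-cong (allMaps l m) (λ g → Σ-comm (λ y x → G (x ◂ (y ◂ g))) (allFin m) (allFin m)) ⟩
        Σ (map (λ g → Σ (map (λ x → Σ (map (λ y → G (x ◂ (y ◂ g))) (allFin m))) (allFin m))) (allMaps l m))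
      ≈⟨ Σ-cong (allMaps l m) (λ g → Σ-cong (allFin m) (λ x → Σ-cong (allFin m) (λ y → G-resp (swap₀ x y g)))) ⟩
        Σ (map (λ g → Σ (map (λ x → Σ (map (λ y → G′ (y ◂ (x ◂ g))) (allFin m))) (allFin m))) (allMaps l m))
      ≈⟨ sym (unfold₂ G′ (λ π≗π′ → G-resp (λ i → π≗π′ (swapAt Fin.zero i)))) ⟩
        Σ (map G′ (allMaps (suc (suc l)) m))
      ∎
      where
      G′ : (Fin (suc (suc l)) → Fin m) → Carrier
      G′ π = G (λ i → π (swapAt Fin.zero i))
      swap₀ : ∀ x y g i → (x ◂ (y ◂ g)) i ≡ (y ◂ (x ◂ g)) (swapAt Fin.zero i)
      swap₀ x y g Fin.zero                = ≡.refl
      swap₀ x y g (Fin.suc Fin.zero)      = ≡.refl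
      swap₀ x y g (Fin.suc (Fin.suc i))   = ≡.refl
      unfold₂ : (H : (Fin (suc (suc l)) → Fin m) → Carrier) → RespectsPointwise H →
                Σ (map H (allMaps (suc (suc l)) m))
                  ≈ Σ (map (λ g → Σ (map (λ y → Σ (map (λ x → H (x ◂ (y ◂ g))) (allFin m))) (allFin m))) (allMaps l m))
      unfold₂ H H-resp = trans (Σ-allMaps-suc H H-resp)
        (Σ-allMaps-suc (λ f → Σ (map (λ x → H (x ◂ f)) (allFin m))) (λ f≗f′ → Σ-cong (allFin m) (λ x → H-resp (◂-cong x f≗f′))))
    Σ-allMaps-swapAt {suc l} (Fin.suc k) G G-resp = begin
        Σ (map G (allMaps (suc (suc l)) m))
      ≈⟨ Σ-allMaps-suc G G-resp ⟩
        Σ (map G′ (allMaps (suc l) m))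
      ≈⟨ Σ-allMaps-swapAt k G′ (λ f≗f′ → Σ-cong (allFin m) (λ x → G-resp (◂-cong x f≗f′))) ⟩
        Σ (map (λ f → G′ (λ i → f (swapAt k i))) (allMaps (suc l) m))
      ≈⟨ Σ-cong (allMaps (suc l) m) (λ f → Σ-cong (allFin m) (λ x → G-resp (swap-suc x f))) ⟩
        Σ (map (λ f → Σ (map (λ x → G (λ i → (x ◂ f) (swapAt (Fin.suc k) i))) (allFin m))) (allMaps (suc l) m))
      ≈⟨ sym (Σ-allMaps-suc (λ π → G (λ i → π (swapAt (Fin.suc k) i))) (λ π≗π′ → G-resp (λ i → π≗π′ (swapAt (Fin.suc k) i)))) ⟩
        Σ (map (λ π → G (λ i → π (swapAt (Fin.suc k) i))) (allMaps (suc (suc l)) m))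
      ∎
      where
      G′ : (Fin (suc l) → Fin m) → Carrier
      G′ f = Σ (map (λ x → G (x ◂ f)) (allFin m))
      swap-suc : ∀ x f i → (x ◂ (λ i → f (swapAt k i))) i ≡ (x ◂ f) (swapAt (Fin.suc k) i)
      swap-suc x f Fin.zero    = ≡.refl
      swap-suc x f (Fin.suc i) = ≡.refl

private
  module ∧ = BigOperators Bool.∧-commutativeMonoid
  module ×ℤ = BigOperators ℤ.*-1-commutativeMonoid

distinct : {n : ℕ} → (Fin n → Fin n) → Fin n → Fin n → Bool
distinct f i j = not (does (f i Fin.≟ f j))

inversionSign : {n : ℕ} → (Fin n → Fin n) → Fin n → Fin n → ℤ
inversionSign f i j = if does (toℕ (f j) ℕ.<? toℕ (f i)) then -[1+ 0 ] else 1ℤ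

isPerm-pairProduct : {n : ℕ} (f : Fin n → Fin n) → isPerm f ≡ ∧.pairProduct n (distinct f)
isPerm-pairProduct {n} f = ≡.trans (foldr≡Σ (pairs n)) (∧.Σ-pairs n (λ (i , j) → distinct f i j))
  where
  foldr≡Σ : ∀ L → foldr (λ { (i , j) b → not (does (f i Fin.≟ f j)) ∧ b }) true L ≡ ∧.Σ (map (λ (i , j) → distinct f i j) L)
  foldr≡Σ []            = ≡.refl
  foldr≡Σ ((i , j) ∷ L) = ≡.cong (distinct f i j ∧_) (foldr≡Σ L)

power-length-filter : ∀ {a p} {A : Set a} {P : Pred A p} (P? : Decidable P) (L : List A) →
                      -[1+ 0 ] ℤ.^ List.length (filter P? L) ≡ ×ℤ.Σ (map (λ x → if does (P? x) then -[1+ 0 ] else 1ℤ) L)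
power-length-filter P? []      = ≡.refl
power-length-filter P? (x ∷ L) with does (P? x)
... | true  = ≡.cong (ℤ._*_ -[1+ 0 ]) (power-length-filter P? L)
... | false = ≡.trans (power-length-filter P? L) (≡.sym (ℤ.*-identityˡ _))

sgn-pairProduct : {n : ℕ} (f : Fin n → Fin n) → sgn f ≡ ×ℤ.pairProduct n (inversionSign f)
sgn-pairProduct {n} f = ≡.trans (power-length-filter _ (pairs n)) (×ℤ.Σ-pairs n (λ x → inversionSign f (proj₁ x) (proj₂ x)))

isPerm-resp : {n : ℕ} {f f′ : Fin n → Fin n} → (∀ i → f i ≡ f′ i) → isPerm f ≡ isPerm f′
isPerm-resp {n} {f} {f′} f≗f′ = ≡.trans (isPerm-pairProduct f) (≡.trans
  (∧.pairProduct-cong n (λ i j → ≡.cong₂ (λ x y → not (does (x Fin.≟ y))) (f≗f′ i) (f≗f′ j))) (≡.sym (isPerm-pairProduct f′)))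

sgn-resp : {n : ℕ} {f f′ : Fin n → Fin n} → (∀ i → f i ≡ f′ i) → sgn f ≡ sgn f′
sgn-resp {n} {f} {f′} f≗f′ = ≡.trans (sgn-pairProduct f) (≡.trans
  (×ℤ.pairProduct-cong n (λ i j → ≡.cong₂ (λ x y → if does (toℕ y ℕ.<? toℕ x) then -[1+ 0 ] else 1ℤ) (f≗f′ i) (f≗f′ j)))
  (≡.sym (sgn-pairProduct f′)))

pairProduct-true : {l : ℕ} (k : Fin l) (c : Fin (suc l) → Fin (suc l) → Bool) →
                   ∧.pairProduct (suc l) c ≡ true → c (inject₁ k) (Fin.suc k) ≡ true
pairProduct-true {suc l} Fin.zero    c all-true =
  Bool.∧-conicalˡ _ _ (Bool.∧-conicalˡ (c Fin.zero (Fin.suc Fin.zero) ∧ ∧.sum (λ i → c Fin.zero (Fin.suc (Fin.suc i)))) _ all-true)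
pairProduct-true {suc l} (Fin.suc k) c all-true =
  pairProduct-true k (λ i j → c (Fin.suc i) (Fin.suc j)) (Bool.∧-conicalʳ (∧.sum (λ j → c Fin.zero (Fin.suc j))) _ all-true)

distinct-sym : {n : ℕ} (f : Fin n → Fin n) (i j : Fin n) → distinct f i j ≡ distinct f j i
distinct-sym f i j with f i Fin.≟ f j | f j Fin.≟ f i
... | yes _     | yes _     = ≡.refl
... | no  _     | no  _     = ≡.refl
... | yes fi≡fj | no  fj≢fi = ⊥-elim (fj≢fi (≡.sym fi≡fj))
... | no  fi≢fj | yes fj≡fi = ⊥-elim (fi≢fj (≡.sym fj≡fi))

isPerm⇒adjacent-distinct : {l : ℕ} (k : Fin l) (f : Fin (suc l) → Fin (suc l)) →
                           isPerm f ≡ true → f (inject₁ k) ≢ f (Fin.suc k)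
isPerm⇒adjacent-distinct k f perm fk≡fk+1 =
  false≢true (≡.trans (≡.sym (≡.cong not (dec-true (f (inject₁ k) Fin.≟ f (Fin.suc k)) fk≡fk+1))) adjacent-distinct)
  where
  adjacent-distinct : distinct f (inject₁ k) (Fin.suc k) ≡ true
  adjacent-distinct = pairProduct-true k (distinct f) (≡.trans (≡.sym (isPerm-pairProduct f)) perm)
  false≢true : false ≢ true
  false≢true ()

∧-cancelʳ : ∀ {a a′ c : Bool} → (a ≡ true → c ≡ true) → (a′ ≡ true → c ≡ true) → a′ ∧ c ≡ a ∧ c → a′ ≡ a
∧-cancelʳ {a}     {a′}    {true}  _       _        a′∧c≡a∧c =
  ≡.trans (≡.sym (Bool.∧-identityʳ a′)) (≡.trans a′∧c≡a∧c (Bool.∧-identityʳ a))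
∧-cancelʳ {false} {false} {false} _       _        _        = ≡.refl
∧-cancelʳ {true}  {_}     {false} a⇒c     _        _        with a⇒c ≡.refl
... | ()
∧-cancelʳ {_}     {true}  {false} _       a′⇒c     _        with a′⇒c ≡.refl
... | ()

isPerm-swapAt : {l : ℕ} (k : Fin l) (f : Fin (suc l) → Fin (suc l)) → isPerm (λ i → f (swapAt k i)) ≡ isPerm f
isPerm-swapAt {l} k f = ≡.trans (isPerm-pairProduct f∘swap)
  (≡.trans (∧-cancelʳ (pairProduct-true k (distinct f)) A′⇒c A′∧c≡A∧c) (≡.sym (isPerm-pairProduct f)))
  where
  f∘swap : Fin (suc l) → Fin (suc l)
  f∘swap i = f (swapAt k i)
  A′⇒c : ∧.pairProduct (suc l) (distinct f∘swap) ≡ true → distinct f (inject₁ k) (Fin.suc k) ≡ true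
  A′⇒c A′-true = ≡.trans (distinct-sym f (inject₁ k) (Fin.suc k))
    (≡.trans (≡.cong₂ (distinct f) (≡.sym (swapAt-inject₁ k)) (≡.sym (swapAt-suc k))) (pairProduct-true k (distinct f∘swap) A′-true))
  A′∧c≡A∧c : ∧.pairProduct (suc l) (distinct f∘swap) ∧ distinct f (inject₁ k) (Fin.suc k)
           ≡ ∧.pairProduct (suc l) (distinct f) ∧ distinct f (inject₁ k) (Fin.suc k)
  A′∧c≡A∧c = ≡.trans (∧.pairProduct-swapAt k (distinct f)) (≡.cong (_ ∧_) (distinct-sym f (Fin.suc k) (inject₁ k)))

sgn-swapAt : {l : ℕ} (k : Fin l) (f : Fin (suc l) → Fin (suc l)) → f (inject₁ k) ≢ f (Fin.suc k) →
             sgn (λ i → f (swapAt k i)) ≡ ℤ.- sgn f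
sgn-swapAt {l} k f fk≢fk+1 = ≡.trans (sgn-pairProduct (λ i → f (swapAt k i)))
  (≡.trans (cancel-sign (b ℕ.<? a) (a ℕ.<? b) (×ℤ.pairProduct-swapAt k (inversionSign f))) (≡.cong ℤ.-_ (≡.sym (sgn-pairProduct f))))
  where
  a b : ℕ
  a = toℕ (f (inject₁ k))
  b = toℕ (f (Fin.suc k))
  sign : ∀ {P : Set} → Dec P → ℤ
  sign P? = if does P? then -[1+ 0 ] else 1ℤ
  cancel-sign : ∀ {X Y} (b<a? : Dec (b ℕ.< a)) (a<b? : Dec (a ℕ.< b)) → X ℤ.* sign b<a? ≡ Y ℤ.* sign a<b? → X ≡ ℤ.- Y
  cancel-sign (yes b<a) (yes a<b) _ = ⊥-elim (ℕ.<-asym b<a a<b)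
  cancel-sign {X} {Y} (yes _) (no _) X*-1≡Y*1 =
    ≡.trans (≡.sym (ℤ.neg-involutive X))
      (≡.cong ℤ.-_ (≡.trans (≡.sym (≡.trans (ℤ.*-comm X _) (ℤ.-1*i≡-i X))) (≡.trans X*-1≡Y*1 (ℤ.*-identityʳ Y))))
  cancel-sign {X} {Y} (no _) (yes _) X*1≡Y*-1 =
    ≡.trans (≡.sym (ℤ.*-identityʳ X)) (≡.trans X*1≡Y*-1 (≡.trans (ℤ.*-comm Y _) (ℤ.-1*i≡-i Y)))
  cancel-sign (no b≮a) (no a≮b) _ = ⊥-elim (fk≢fk+1 (Fin.toℕ-injective (ℕ.≤-antisym (ℕ.≮⇒≥ b≮a) (ℕ.≮⇒≥ a≮b))))

module AlternatingSum {N l : ℕ} (j : Fin l)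
  (Prod : (Fin (suc l) → Poly N) → Poly N)
  (Prod-cong : ∀ {F F′} → (∀ i → F i ≡ F′ i) → Prod F ≡ Prod F′)
  (Prod-swapAt : ∀ F → F (inject₁ j) ⊗ F (Fin.suc j) ≈ᴮ F (Fin.suc j) ⊗ F (inject₁ j) → Prod (λ i → F (swapAt j i)) ≈ᴮ Prod F)
  (F : (Fin (suc l) → Fin (suc l)) → Fin (suc l) → Poly N)
  (F-resp : ∀ {π π′} → (∀ i → π i ≡ π′ i) → ∀ i → F π i ≡ F π′ i)
  (F-swapAt : ∀ π i → F (λ x → π (swapAt j x)) i ≡ F π (swapAt j i))
  (F-commute : ∀ π → F π (inject₁ j) ⊗ F π (Fin.suc j) ≈ᴮ F π (Fin.suc j) ⊗ F π (inject₁ j))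
  where

  open BigOperators (Ring.+-commutativeMonoid (quotientRing N))
  open import Relation.Binary.Reasoning.Setoid (Ring.setoid (quotientRing N))

  Perm : Set
  Perm = Fin (suc l) → Fin (suc l)

  swapped : Perm → Perm
  swapped π i = π (swapAt j i)

  term : Perm → Poly N
  term π = scale (sgn π) (Prod (F π))

  term-resp : ∀ {π π′} → (∀ i → π i ≡ π′ i) → term π ≡ term π′
  term-resp π≗π′ = ≡.cong₂ scale (sgn-resp π≗π′) (Prod-cong (F-resp π≗π′))

  term-swapped : ∀ π → isPerm π ≡ true → term π ⊕ term (swapped π) ≈ᴮ []
  term-swapped π perm = ≈ᴮ-trans (⊕-cong (≡⇒≈ᴮ ≡.refl) negated) (scale-cancel (sgn π) (Prod (F π)))
    where
    negated : term (swapped π) ≈ᴮ scale (ℤ.- sgn π) (Prod (F π))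
    negated = ≈ᴮ-trans (≡⇒≈ᴮ (≡.cong₂ scale (sgn-swapAt j π (isPerm⇒adjacent-distinct j π perm)) (Prod-cong (F-swapAt π))))
                       (scale-cong (ℤ.- sgn π) (Prod-swapAt (F π) (F-commute π)))

  ascending descending : Perm → Bool
  ascending  π = does (toℕ (π (inject₁ j)) ℕ.<? toℕ (π (Fin.suc j)))
  descending π = does (toℕ (π (Fin.suc j)) ℕ.<? toℕ (π (inject₁ j)))

  lower upper : Perm → Poly N
  lower π = if isPerm π ∧ ascending π then term π else []
  upper π = if isPerm π ∧ descending π then term π else []

  upper-resp : ∀ {π π′} → (∀ i → π i ≡ π′ i) → upper π ≈ᴮ upper π′
  upper-resp {π} {π′} π≗π′ = ≡⇒≈ᴮ (≡.cong₂ (λ guard t → if guard then t else [])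
    (≡.cong₂ _∧_ (isPerm-resp π≗π′) (≡.cong₂ (λ x y → does (toℕ x ℕ.<? toℕ y)) (π≗π′ (Fin.suc j)) (π≗π′ (inject₁ j))))
    (term-resp π≗π′))

  split : ∀ π → (if isPerm π then term π else []) ≈ᴮ lower π ⊕ upper π
  split π = by-cases (isPerm π) ≡.refl (toℕ (π (inject₁ j)) ℕ.<? toℕ (π (Fin.suc j))) (toℕ (π (Fin.suc j)) ℕ.<? toℕ (π (inject₁ j)))
    where
    by-cases : ∀ p → isPerm π ≡ p → (asc : Dec (toℕ (π (inject₁ j)) ℕ.< toℕ (π (Fin.suc j))))
                                   (desc : Dec (toℕ (π (Fin.suc j)) ℕ.< toℕ (π (inject₁ j)))) →
               (if p then term π else []) ≈ᴮ (if p ∧ does asc then term π else []) ⊕ (if p ∧ does desc then term π else [])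
    by-cases false _    _          _           = ≡⇒≈ᴮ ≡.refl
    by-cases true  _    (yes π<)   (yes π>)    = ⊥-elim (ℕ.<-asym π< π>)
    by-cases true  _    (yes _)    (no _)      = ≡⇒≈ᴮ (≡.sym (List.++-identityʳ (term π)))
    by-cases true  _    (no _)     (yes _)     = ≡⇒≈ᴮ ≡.refl
    by-cases true  perm (no π≮)    (no π≯)     =
      ⊥-elim (isPerm⇒adjacent-distinct j π perm (Fin.toℕ-injective (ℕ.≤-antisym (ℕ.≮⇒≥ π≯) (ℕ.≮⇒≥ π≮))))

  lower+upper∘swapped : ∀ π → lower π ⊕ upper (swapped π) ≈ᴮ []
  lower+upper∘swapped π = ≈ᴮ-trans (⊕-cong (≡⇒≈ᴮ ≡.refl) (≡⇒≈ᴮ upper-swapped))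
    (both-or-neither (isPerm π ∧ ascending π) (λ guard → term-swapped π (Bool.∧-conicalˡ _ _ guard)))
    where
    upper-swapped : upper (swapped π) ≡ (if isPerm π ∧ ascending π then term (swapped π) else [])
    upper-swapped = ≡.cong₂ (λ p b → if p ∧ b then term (swapped π) else [])
      (isPerm-swapAt j π) (≡.cong₂ (λ x y → does (toℕ (π x) ℕ.<? toℕ (π y))) (swapAt-suc j) (swapAt-inject₁ j))
    both-or-neither : ∀ {X Y} b → (b ≡ true → X ⊕ Y ≈ᴮ []) → (if b then X else []) ⊕ (if b then Y else []) ≈ᴮ []
    both-or-neither true  X⊕Y≈0 = X⊕Y≈0 ≡.refl
    both-or-neither false _     = ≡⇒≈ᴮ ≡.refl

  alternating-sum-vanishes : Σ (map term (Sym (suc l))) ≈ᴮ []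
  alternating-sum-vanishes = begin
      Σ (map term (Sym (suc l)))                                ≈⟨ Σ-filter (λ π → T? (isPerm π)) term maps ⟩
      Σ (map (λ π → if isPerm π then term π else []) maps)     ≈⟨ Σ-cong maps split ⟩
      Σ (map (λ π → lower π ⊕ upper π) maps)                    ≈⟨ Σ-∙ lower upper maps ⟩
      Σ (map lower maps) ⊕ Σ (map upper maps)                   ≈⟨ ⊕-cong (≡⇒≈ᴮ ≡.refl) (Σ-allMaps-swapAt j upper upper-resp) ⟩
      Σ (map lower maps) ⊕ Σ (map (λ π → upper (swapped π)) maps) ≈⟨ ≈ᴮ-sym (Σ-∙ lower (λ π → upper (swapped π)) maps) ⟩
      Σ (map (λ π → lower π ⊕ upper (swapped π)) maps)          ≈⟨ Σ-cong maps lower+upper∘swapped ⟩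
      Σ (map (λ _ → []) maps)                                   ≈⟨ Σ-ε maps ⟩
      []                                                        ∎
    where
    maps = allMaps (suc l) (suc l)

module _ {N : ℕ} where

  prodAug-cong : ∀ m (w : Fin m → Word N) {F F′ : Fin (suc m) → Poly N} → (∀ i → F i ≡ F′ i) → prodAug m F w ≡ prodAug m F′ w
  prodAug-cong zero    w F≗F′ = F≗F′ Fin.zero
  prodAug-cong (suc m) w F≗F′ =
    ≡.cong₂ _⊗_ (≡.cong (_⊗ mono (w Fin.zero)) (F≗F′ Fin.zero)) (prodAug-cong m (λ i → w (Fin.suc i)) (λ i → F≗F′ (Fin.suc i)))

  ⊗-swapˡ : ∀ (a b r : Poly N) → a ⊗ b ≈ᴮ b ⊗ a → a ⊗ (b ⊗ r) ≈ᴮ b ⊗ (a ⊗ r)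
  ⊗-swapˡ a b r ab≈ba = ≈ᴮ-trans (≡⇒≈ᴮ (≡.sym (⊗-assoc a b r))) (≈ᴮ-trans (⊗-congˡ r ab≈ba) (≡⇒≈ᴮ (⊗-assoc b a r)))

  prodAug-rest : (m : ℕ) → (Fin m → Poly N) → (Fin m → Word N) → Poly N
  prodAug-rest zero    F w = one
  prodAug-rest (suc m) F w = mono (w Fin.zero) ⊗ prodAug m F (λ i → w (Fin.suc i))

  prodAug-first : ∀ m (F : Fin (suc m) → Poly N) w → prodAug m F w ≡ F Fin.zero ⊗ prodAug-rest m (λ i → F (Fin.suc i)) w
  prodAug-first zero    F w = ≡.sym (⊗-identityʳ (F Fin.zero))
  prodAug-first (suc m) F w = ⊗-assoc (F Fin.zero) _ _

  prodL≡prodAug : ∀ m (F : Fin (suc m) → Poly N) → prodL (suc m) F ≡ prodAug m F (λ _ → [])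
  prodL≡prodAug zero    F = ⊗-identityʳ (F Fin.zero)
  prodL≡prodAug (suc m) F = ≡.cong₂ _⊗_ (≡.sym (⊗-identityʳ (F Fin.zero))) (prodL≡prodAug m (λ i → F (Fin.suc i)))

  prodAug-swapAt : ∀ l (k : Fin l) (F : Fin (suc l) → Poly N) (w : Fin l → Word N) → w k ≡ [] →
                   F (inject₁ k) ⊗ F (Fin.suc k) ≈ᴮ F (Fin.suc k) ⊗ F (inject₁ k) →
                   prodAug l (λ i → F (swapAt k i)) w ≈ᴮ prodAug l F w
  prodAug-swapAt (suc l) Fin.zero F w w₀≡[] F₀F₁≈F₁F₀ = begin
      (F₁ ⊗ mono (w Fin.zero)) ⊗ prodAug l (λ i → F (swapAt Fin.zero (Fin.suc i))) w′
    ≡⟨ ≡.cong₂ _⊗_ (drop-separator F₁) (prodAug-first l _ w′) ⟩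
      F₁ ⊗ (F₀ ⊗ rest)
    ≈⟨ ⊗-swapˡ F₁ F₀ rest (≈ᴮ-sym F₀F₁≈F₁F₀) ⟩
      F₀ ⊗ (F₁ ⊗ rest)
    ≡⟨ ≡.sym (≡.cong₂ _⊗_ (drop-separator F₀) (prodAug-first l _ w′)) ⟩
      (F₀ ⊗ mono (w Fin.zero)) ⊗ prodAug l (λ i → F (Fin.suc i)) w′
    ∎
    where
    open import Relation.Binary.Reasoning.Setoid (Ring.setoid (quotientRing N))
    F₀ = F Fin.zero
    F₁ = F (Fin.suc Fin.zero)
    w′ = λ i → w (Fin.suc i)
    rest = prodAug-rest l (λ i → F (Fin.suc (Fin.suc i))) w′
    drop-separator : ∀ G → G ⊗ mono (w Fin.zero) ≡ G
    drop-separator G = ≡.trans (≡.cong (λ v → G ⊗ mono v) w₀≡[]) (⊗-identityʳ G)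
  prodAug-swapAt (suc l) (Fin.suc k) F w wk≡[] comm =
    ⊗-congʳ (F Fin.zero ⊗ mono (w Fin.zero)) (prodAug-swapAt l k (λ i → F (Fin.suc i)) (λ i → w (Fin.suc i)) wk≡[] comm)

open import Data.Nat using (_+_)

module AdjacentEqualParts {N l : ℕ} (α : Fin (suc l) → ℕ) (n : Fin (suc l) → Fin (suc N)) (j : Fin l)
  (α-step : α (Fin.suc j) ≡ α (inject₁ j) + 1) (n-equal : n (Fin.suc j) ≡ n (inject₁ j)) where

  factor : (Fin (suc l) → Fin (suc l)) → Fin (suc l) → Poly N
  factor π i = e (idx {N = N} α π i) (toℕ (n i))

  factor-resp : ∀ {π π′} → (∀ i → π i ≡ π′ i) → ∀ i → factor π i ≡ factor π′ i
  factor-resp π≗π′ i = ≡.cong (λ x → e ((+ α i ℤ.+ + toℕ x) ℤ.- + toℕ i) (toℕ (n i))) (π≗π′ i)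

  shifted : Fin (suc l) → ℤ
  shifted i = + α i ℤ.- + toℕ i

  shifted-swapAt : ∀ i → shifted (swapAt j i) ≡ shifted i
  shifted-swapAt = swapAt-invariant shifted j (begin
      + α (inject₁ j) ℤ.- + toℕ (inject₁ j)
    ≡⟨ ≡.cong (λ t → + α (inject₁ j) ℤ.- + t) (Fin.toℕ-inject₁ j) ⟩
      + α (inject₁ j) ℤ.- + toℕ j
    ≡⟨ shift-both (+ α (inject₁ j)) (+ toℕ j) ⟩
      (+ α (inject₁ j) ℤ.+ + 1) ℤ.- (+ 1 ℤ.+ + toℕ j)
    ≡⟨ ≡.cong₂ ℤ._-_ (≡.trans (≡.sym (ℤ.pos-+ (α (inject₁ j)) 1)) (≡.cong +_ (≡.sym α-step))) (≡.sym (ℤ.pos-+ 1 (toℕ j))) ⟩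
      + α (Fin.suc j) ℤ.- + toℕ (Fin.suc j)
    ∎)
    where
    open ≡.≡-Reasoning
    shift-both : ∀ a t → a ℤ.- t ≡ (a ℤ.+ + 1) ℤ.- (+ 1 ℤ.+ t)
    shift-both = solve-∀

  factor-swapAt : ∀ π i → factor (λ x → π (swapAt j x)) i ≡ factor π (swapAt j i)
  factor-swapAt π i = ≡.cong₂ e
    (≡.trans (regroup (+ α i) (+ toℕ (π (swapAt j i))) (+ toℕ i))
      (≡.trans (≡.cong (ℤ._+ + toℕ (π (swapAt j i))) (≡.sym (shifted-swapAt i)))
        (≡.sym (regroup (+ α (swapAt j i)) (+ toℕ (π (swapAt j i))) (+ toℕ (swapAt j i))))))
    (≡.cong toℕ (≡.sym (swapAt-invariant n j (≡.sym n-equal) i)))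
    where
    regroup : ∀ a p t → (a ℤ.+ p) ℤ.- t ≡ (a ℤ.- t) ℤ.+ p
    regroup = solve-∀

  factor-commute : ∀ π → factor π (inject₁ j) ⊗ factor π (Fin.suc j) ≈ᴮ factor π (Fin.suc j) ⊗ factor π (inject₁ j)
  factor-commute π = ≡.subst (λ m → e a m₀ ⊗ e b m ≈ᴮ e b m ⊗ e a m₀) (≡.cong toℕ (≡.sym n-equal)) (e-commute a b m₀)
    where
    a b : ℤ
    a = idx {N = N} α π (inject₁ j)
    b = idx {N = N} α π (Fin.suc j)
    m₀ : ℕ
    m₀ = toℕ (n (inject₁ j))

lemma9p7 : (N l : ℕ) (α : Fin (suc l) → ℕ) (n : Fin (suc l) → Fin (suc N)) (j : Fin l) →
    α (Fin.suc j) ≡ α (inject₁ j) + 1 → n (Fin.suc j) ≡ n (inject₁ j) →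
    (J (suc l) α n ≡B [])
    × ((w : Fin l → Word N) → w j ≡ [] → Jaug l α n w ≡B [])
lemma9p7 N l α n j α-step n-equal = inIdeal (≈ᴮ-trans J≈Jaug (mk≈ᴮ (Jaug-vanishes (λ _ → []) ≡.refl))) , Jaug-vanishes
  where
  open AdjacentEqualParts α n j α-step n-equal
  open BigOperators (Ring.+-commutativeMonoid (quotientRing N)) using (Σ-cong)

  Jaug-vanishes : (w : Fin l → Word N) → w j ≡ [] → Jaug l α n w ≡B []
  Jaug-vanishes w wj≡[] = inIdeal (AlternatingSum.alternating-sum-vanishes j
    (λ G → prodAug l G w) (prodAug-cong l w) (λ G → prodAug-swapAt l j G w wj≡[])
    factor factor-resp factor-swapAt factor-commute)

  J≈Jaug : J (suc l) α n ≈ᴮ Jaug l α n (λ _ → [])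
  J≈Jaug = Σ-cong (Sym (suc l)) (λ π → ≡⇒≈ᴮ (≡.cong (scale (sgn π)) (prodL≡prodAug l (factor π))))
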